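{- Let $H$ be the graph on vertex set $\{0,1,2,3\}$ with red edge set $\{\{0,2\},\{0,3\}\}$ and blue edge set $\{\{0,1\},\{2,3\}\}$. Then $\lambda_H=1/8$, the semi-inducibility problem for $H$ is perfectly $K_2$-stable, and the unique maximizer of $\lambda_H(K_2(\mathbf a))$ over vectors $\mathbf a$ of two non-negative reals summing to $1$ is $\mathbf a=(1/2,1/2)$.
   Context: All graphs are finite and simple; the order of a graph is its number of vertices. For a graph $H$ with $\kappa$ vertices whose edges are coloured red or blue and an uncoloured graph $G$ of order $n\ge\kappa$, an embedding of $H$ into $G$ is an injection $V(H)\to V(G)$ that maps red edges of $H$ to edges of $G$ and blue edges of $H$ to non-edges of $G$ (pairs of distinct non-adjacent vertices). $\Lambda_H(G)$ is the number of embeddings, $\lambda_H(G):=\Lambda_H(G)/\big(n(n-1)\cdots(n-\kappa+1)\big)$, $\lambda_H(n)$ is the maximum of $\lambda_H(G)$ over all graphs $G$ of order $n$, and $\lambda_H:=\lim_{n\to\infty}\lambda_H(n)$ (the limit exists). For a graph $B$ on $\{0,\dots,m-1\}$ and pairwise disjoint finite sets $V_0,\dots,V_{m-1}$ (some possibly empty), the blowup $B(V_0,\dots,V_{m-1})$ is the graph on $\bigcup_i V_i$ in which $x\in V_i$ and $y\in V_j$ are adjacent if and only if $\{i,j\}\in E(B)$. For a vector $\mathbf a=(a_0,\dots,a_{m-1})$ of non-negative reals summing to $1$, $\lambda_H(B(\mathbf a))$ denotes the limit as $n\to\infty$ of $\lambda_H(B(V_0,\dots,V_{m-1}))$ where $\sum_i|V_i|=n$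 and $|V_i|=(a_i+o(1))n$. Equivalently, it is $\sum_f\prod_{i\in V(H)}a_{f(i)}$, the sum being over all maps $f:V(H)\to V(B)$ sending every red edge of $H$ to an edge of $B$ and every blue edge to a non-edge of $B$ or to two equal vertices. The edit distance $\delta_{\mathrm{edit}}(G,G')$ between two graphs of the same order is the minimum of $|f(E(G))\bigtriangleup E(G')|$ over all bijections $f:V(G)\to V(G')$. The semi-inducibility problem for $H$ is perfectly $B$-stable if there is $C>0$ such that for every graph $G$ of order $n\ge C$ there is a blowup $G'$ of $B$ of order $n$ with $\delta_{\mathrm{edit}}(G,G')\le C\,(\lambda_H(n)-\lambda_H(G))\,n^2$. (Here $C\ge\kappa$ may be assumed.) -}

module Defs where

open import Data.Bool.Base using (Bool; true; false; _∧_; _∨_; not)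
import Data.Bool.Properties as Bool
open import Data.Fin.Base using (Fin; zero; suc)
open import Data.Fin.Patterns using (0F; 1F; 2F; 3F)
import Data.Fin.Base as Fin
import Data.Fin.Properties as Fin
open import Data.Fin.Permutation as Perm using (Permutation′; _⟨$⟩ˡ_; _⟨$⟩ʳ_)
import Data.Integer.Base as ℤ
open import Data.List.Base
  using (List; []; _∷_; [_]; length; map; filter; foldr; allFin; cartesianProduct; cartesianProductWith)
import Data.List.Extrema as Extrema
open import Data.List.Properties using (filter-≐)
open import Data.List.Membership.Propositional using (_∈_)
open import Data.List.Membership.Propositional.Properties
  using (∈-allFin; ∈-cartesianProductWith⁺; ∈-map⁺)
import Data.List.Membership.DecPropositional as DecMembership
open import Data.List.Relation.Unary.Any using (here; there)
import Data.List.Relation.Unary.All as All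
open import Data.Nat.Base as ℕ using (ℕ; zero; suc)
import Data.Nat.Properties as ℕ
open import Data.Nat.Combinatorics.Base using (_P′_)
open import Data.Product.Base using (Σ-syntax; ∃-syntax; _×_; _,_)
open import Data.Product.Properties using (≡-dec)
open import Data.Rational.Base as ℚ using (ℚ; 0ℚ; 1ℚ; ½; _/_; ∣_∣)
import Data.Rational.Properties as ℚ
import Data.Rational.Solver as ℚ
open import Data.Vec.Base using (Vec; []; _∷_; lookup; tabulate)
open import Data.Vec.Properties using (lookup∘tabulate)
open import Function.Definitions using (Injective)
open import Relation.Binary.Bundles using (DecTotalOrder)
open import Relation.Binary.PropositionalEquality hiding ([_])
open import Relation.Nullary.Decidable
  using (Dec; yes; no; ⌊_⌋; _×-dec_; _→-dec_; ¬?; map′; from-yes)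
open import Relation.Nullary.Negation using (contradiction)

vectors : ∀ {A : Set} → List A → ∀ k → List (Vec A k)
vectors xs zero    = [ [] ]
vectors xs (suc k) = cartesianProductWith _∷_ xs (vectors xs k)

∈-vectors : ∀ {A : Set} {xs : List A} → (∀ x → x ∈ xs) → ∀ {k} (v : Vec A k) → v ∈ vectors xs k
∈-vectors all []      = here refl
∈-vectors all (x ∷ v) = ∈-cartesianProductWith⁺ _∷_ (all x) (∈-vectors all v)

-- All functions Fin k → Fin n, each as the vector of its values.
allMaps : ∀ k n → List (Vec (Fin n) k)
allMaps k n = vectors (allFin n) k

allPermutations : ∀ n → List (Permutation′ n)
allPermutations zero    = [ Perm.id ]
allPermutations (suc n) =
  cartesianProductWith (Perm.insert 0F) (allFin (suc n)) (allPermutations n)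

allPermutations-complete : ∀ {n} (π : Permutation′ n) →
  ∃[ ρ ] ρ ∈ allPermutations n × ρ Perm.≈ π
allPermutations-complete {zero}  π = Perm.id , here refl , λ ()
allPermutations-complete {suc n} π
  with ρ , ρ∈ , ρ≈ ← allPermutations-complete (Perm.remove 0F π)
  = Perm.insert 0F (π ⟨$⟩ʳ 0F) ρ
  , ∈-cartesianProductWith⁺ (Perm.insert 0F) (∈-allFin (π ⟨$⟩ʳ 0F)) ρ∈
  , λ i → trans (insert-cong i) (Perm.insert-remove 0F π i)
  where
  insert-cong : Perm.insert 0F (π ⟨$⟩ʳ 0F) ρ Perm.≈ Perm.insert 0F (π ⟨$⟩ʳ 0F) (Perm.remove 0F π)
  insert-cong zero    = refl
  insert-cong (suc i) = cong (Fin.punchIn (π ⟨$⟩ʳ 0F)) (ρ≈ i)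

record Graph (n : ℕ) : Set where
  field
    adj     : Fin n → Fin n → Bool
    adj-sym : ∀ u v → adj u v ≡ adj v u
    adj-irr : ∀ u → adj u u ≡ false

open Graph public

-- u and v are adjacent when they are distinct and related by r in at least
-- one direction.
fromRelation : ∀ {n} → (Fin n → Fin n → Bool) → Graph n
fromRelation {n} r = record
  { adj     = a
  ; adj-sym = λ u v → cong₂ _∧_ (cong not (≟-sym u v)) (Bool.∨-comm (r u v) (r v u))
  ; adj-irr = a-irr
  }
  where
  a : Fin n → Fin n → Bool
  a u v = not ⌊ u Fin.≟ v ⌋ ∧ (r u v ∨ r v u)

  ≟-sym : ∀ (u v : Fin n) → ⌊ u Fin.≟ v ⌋ ≡ ⌊ v Fin.≟ u ⌋
  ≟-sym u v with u Fin.≟ v | v Fin.≟ u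
  ... | yes _ | yes _ = refl
  ... | no  _ | no  _ = refl
  ... | yes p | no ¬q = contradiction (sym p) ¬q
  ... | no ¬p | yes q = contradiction (sym q) ¬p

  a-irr : ∀ u → a u u ≡ false
  a-irr u with u Fin.≟ u
  ... | yes _ = refl
  ... | no ¬p = contradiction refl ¬p

fromEdges : ∀ {n} → List (Fin n × Fin n) → Graph n
fromEdges es = fromRelation λ u v → ⌊ (u , v) ∈? es ⌋
  where open DecMembership (≡-dec Fin._≟_ Fin._≟_) using (_∈?_)

emptyGraph : ∀ n → Graph n
emptyGraph n = fromRelation λ _ _ → false

completeGraph : ∀ n → Graph n
completeGraph n = fromRelation λ _ _ → true

-- Every graph on Fin n occurs (up to pointwise equality of adjacency), as the
-- symmetrization of some Boolean matrix.
allGraphs : ∀ n → List (Graph n)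
allGraphs n =
  map (λ M → fromRelation λ u v → lookup (lookup M u) v)
      (vectors (vectors (true ∷ false ∷ []) n) n)

allGraphs-complete : ∀ {n} (G : Graph n) →
  ∃[ G′ ] G′ ∈ allGraphs n × (∀ u v → adj G′ u v ≡ adj G u v)
allGraphs-complete {n} G =
  _ , ∈-map⁺ _ (∈-vectors (∈-vectors bools) M) , same
  where
  bools : ∀ b → b ∈ true ∷ false ∷ []
  bools true  = here refl
  bools false = there (here refl)

  M : Vec (Vec Bool n) n
  M = tabulate λ u → tabulate (adj G u)

  lookup-M : ∀ u v → lookup (lookup M u) v ≡ adj G u v
  lookup-M u v = trans (cong (λ row → lookup row v) (lookup∘tabulate _ u)) (lookup∘tabulate _ v)

  same : ∀ u v → adj (fromRelation λ u v → lookup (lookup M u) v) u v ≡ adj G u v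
  same u v rewrite lookup-M u v | lookup-M v u | adj-sym G v u with u Fin.≟ v
  ... | yes refl = sym (adj-irr G u)
  ... | no  _    = Bool.∨-idem (adj G u v)

-- The blowup B(V₀, …, Vₘ₋₁) on vertex set Fin n, where Vᵢ = part ⁻¹(i).
blowup : ∀ {m n} → Graph m → (Fin n → Fin m) → Graph n
blowup B part = record
  { adj     = λ u v → adj B (part u) (part v)
  ; adj-sym = λ u v → adj-sym B (part u) (part v)
  ; adj-irr = λ u → adj-irr B (part u)
  }

relabel : ∀ {n} → Permutation′ n → Graph n → Graph n
relabel π G = record
  { adj     = λ u v → adj G (π ⟨$⟩ˡ u) (π ⟨$⟩ˡ v)
  ; adj-sym = λ u v → adj-sym G _ _
  ; adj-irr = λ u → adj-irr G _
  }

-- |E(G) △ E(G′)|; each unordered pair is counted once, as (u , v) with u < v.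
differences : ∀ {n} → Graph n → Graph n → ℕ
differences {n} G G′ = length (filter differ? (cartesianProduct (allFin n) (allFin n)))
  where
  differ? : ((u , v) : Fin n × Fin n) → Dec (u Fin.< v × adj G u v ≢ adj G′ u v)
  differ? (u , v) = (u Fin.<? v) ×-dec ¬? (adj G u v Bool.≟ adj G′ u v)

editDistance : ∀ {n} → Graph n → Graph n → ℕ
editDistance {n} G G′ = cost (argmin cost Perm.id (allPermutations n))
  where
  open Extrema ℕ.≤-totalOrder using (argmin)
  cost : Permutation′ n → ℕ
  cost π = differences (relabel π G) G′

relabel-cong : ∀ {n} (G G′ : Graph n) (ρ π : Permutation′ n) → ρ Perm.≈ π →
  differences (relabel ρ G) G′ ≡ differences (relabel π G) G′
relabel-cong {n} G G′ ρ π ρ≈π = cong length (filter-≐ _ _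
  ( (λ {(u , v)} (u<v , ≢) → u<v , λ eq → ≢ (trans (adj-≡ u v) eq))
  , (λ {(u , v)} (u<v , ≢) → u<v , λ eq → ≢ (trans (sym (adj-≡ u v)) eq)))
  (cartesianProduct (allFin n) (allFin n)))
  where
  ˡ-cong : ∀ u → ρ ⟨$⟩ˡ u ≡ π ⟨$⟩ˡ u
  ˡ-cong u = trans (cong (ρ ⟨$⟩ˡ_) (sym (trans (ρ≈π (π ⟨$⟩ˡ u)) (Perm.inverseʳ π))))
                   (Perm.inverseˡ ρ)

  adj-≡ : ∀ u v → adj (relabel ρ G) u v ≡ adj (relabel π G) u v
  adj-≡ u v = cong₂ (adj G) (ˡ-cong u) (ˡ-cong v)

editDistance-≤ : ∀ {n} (G G′ : Graph n) (π : Permutation′ n) →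
  editDistance G G′ ℕ.≤ differences (relabel π G) G′
editDistance-≤ {n} G G′ π = go (allPermutations-complete π)
  where
  open Extrema ℕ.≤-totalOrder using (f[argmin]≤f[xs])

  go : ∃[ ρ ] ρ ∈ allPermutations n × ρ Perm.≈ π →
       editDistance G G′ ℕ.≤ differences (relabel π G) G′
  go (ρ , ρ∈ , ρ≈π) = ℕ.≤-trans
    (All.lookup
      (f[argmin]≤f[xs] {f = λ π → differences (relabel π G) G′} Perm.id (allPermutations n)) ρ∈)
    (ℕ.≤-reflexive (relabel-cong G G′ ρ π ρ≈π))

record ColouredGraph (κ : ℕ) : Set where
  field
    red blue : Graph κ
    disjoint : ∀ u v → adj red u v ∧ adj blue u v ≡ false

open ColouredGraph public

-- `adj G x y ≡ false` says that x and y are either equal or distinct and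
-- non-adjacent.  The first alternative is excluded for injective f, and is
-- allowed for the maps defining blowupDensity below.
RespectsColours : ∀ {κ n} → ColouredGraph κ → Graph n → (Fin κ → Fin n) → Set
RespectsColours H G f =
    (∀ u v → adj (red  H) u v ≡ true → adj G (f u) (f v) ≡ true)
  × (∀ u v → adj (blue H) u v ≡ true → adj G (f u) (f v) ≡ false)

IsEmbedding : ∀ {κ n} → ColouredGraph κ → Graph n → (Fin κ → Fin n) → Set
IsEmbedding H G f = Injective _≡_ _≡_ f × RespectsColours H G f

respectsColours? : ∀ {κ n} (H : ColouredGraph κ) (G : Graph n) f → Dec (RespectsColours H G f)
respectsColours? H G f =
  (Fin.all? λ u → Fin.all? λ v → (_ Bool.≟ _) →-dec (_ Bool.≟ _))
  ×-dec
  (Fin.all? λ u → Fin.all? λ v → (_ Bool.≟ _) →-dec (_ Bool.≟ _))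

isEmbedding? : ∀ {κ n} (H : ColouredGraph κ) (G : Graph n) f → Dec (IsEmbedding H G f)
isEmbedding? H G f =
  map′ (λ inj {u} {v} → inj u v) (λ inj u v → inj)
       (Fin.all? λ u → Fin.all? λ v → (f u Fin.≟ f v) →-dec (u Fin.≟ v))
  ×-dec respectsColours? H G f

embeddings : ∀ {κ n} → ColouredGraph κ → Graph n → ℕ
embeddings {κ} {n} H G = length (filter (λ f → isEmbedding? H G (lookup f)) (allMaps κ n))

P′-nonZero : ∀ {n k} → k ℕ.≤ n → ℕ.NonZero (n P′ k)
P′-nonZero {n} {zero}  k≤n = _
P′-nonZero {n} {suc k} k<n =
  ℕ.m*n≢0 (n ℕ.∸ k) (n P′ k) {{ℕ.>-nonZero (ℕ.m<n⇒0<n∸m k<n)}} {{P′-nonZero (ℕ.<⇒≤ k<n)}}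

-- λ_H(G); the denominator n P′ κ is n (n ∸ 1) ⋯ (n ∸ κ + 1).
density : ∀ {κ n} → ColouredGraph κ → Graph n → κ ℕ.≤ n → ℚ
density {κ} {n} H G κ≤n = (ℤ.+ embeddings H G / (n P′ κ)) {{P′-nonZero κ≤n}}

-- λ_H(n)
maxDensity : ∀ {κ} → ColouredGraph κ → ∀ n → κ ℕ.≤ n → ℚ
maxDensity H n κ≤n =
  density H (argmax (λ G → density H G κ≤n) (emptyGraph n) (allGraphs n)) κ≤n
  where open Extrema (DecTotalOrder.totalOrder ℚ.≤-decTotalOrder) using (argmax)

embeddings-cong : ∀ {κ n} (H : ColouredGraph κ) (G G′ : Graph n) →
  (∀ u v → adj G u v ≡ adj G′ u v) → embeddings H G ≡ embeddings H G′
embeddings-cong {κ} {n} H G G′ same = cong length (filter-≐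
  (λ f → isEmbedding? H G (lookup f)) (λ f → isEmbedding? H G′ (lookup f))
  ( (λ (inj , r , b) → inj , (λ u v e → trans (sym (same _ _)) (r u v e))
                           , (λ u v e → trans (sym (same _ _)) (b u v e)))
  , (λ (inj , r , b) → inj , (λ u v e → trans (same _ _) (r u v e))
                           , (λ u v e → trans (same _ _) (b u v e))))
  (allMaps κ n))

density-cong : ∀ {κ n} (H : ColouredGraph κ) (G G′ : Graph n) (κ≤n : κ ℕ.≤ n) →
  embeddings H G ≡ embeddings H G′ → density H G κ≤n ≡ density H G′ κ≤n
density-cong {κ} {n} H G G′ κ≤n =
  cong (λ e → (ℤ.+ e / (n P′ κ)) {{P′-nonZero κ≤n}})

density≤maxDensity : ∀ {κ n} (H : ColouredGraph κ) (G : Graph n) (κ≤n : κ ℕ.≤ n) →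
  density H G κ≤n ℚ.≤ maxDensity H n κ≤n
density≤maxDensity {κ} {n} H G κ≤n = go (allGraphs-complete G)
  where
  open Extrema (DecTotalOrder.totalOrder ℚ.≤-decTotalOrder) using (f[xs]≤f[argmax])

  go : ∃[ G′ ] G′ ∈ allGraphs n × (∀ u v → adj G′ u v ≡ adj G u v) →
       density H G κ≤n ℚ.≤ maxDensity H n κ≤n
  go (G′ , G′∈ , same) = ℚ.≤-trans
    (ℚ.≤-reflexive (density-cong H G G′ κ≤n
      (embeddings-cong H G G′ (λ u v → sym (same u v)))))
    (All.lookup
      (f[xs]≤f[argmax] {f = λ G → density H G κ≤n} (emptyGraph n) (allGraphs n)) G′∈)

-- λ_H = L, that is, λ_H(n) → L as n → ∞.
LimitDensity : ∀ {κ} → ColouredGraph κ → ℚ → Set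
LimitDensity {κ} H L =
  ∀ ε → 0ℚ ℚ.< ε → ∃[ N ] ∀ n → N ℕ.≤ n → (κ≤n : κ ℕ.≤ n) →
  ∣ maxDensity H n κ≤n ℚ.- L ∣ ℚ.< ε

fromℕ : ℕ → ℚ
fromℕ n = ℤ.+ n / 1

-- An integer C loses nothing: since λ_H(n) − λ_H(G) ≥ 0, any admissible C may
-- be replaced by a larger one.
PerfectlyStable : ∀ {κ m} → ColouredGraph κ → Graph m → Set
PerfectlyStable {κ} {m} H B =
  ∃[ C ] 0 ℕ.< C × (∀ n → C ℕ.≤ n → (κ≤n : κ ℕ.≤ n) → (G : Graph n) →
    Σ[ part ∈ (Fin n → Fin m) ]
      fromℕ (editDistance G (blowup B part))
        ℚ.≤ fromℕ C ℚ.* (maxDensity H n κ≤n ℚ.- density H G κ≤n) ℚ.* fromℕ (n ℕ.* n))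

-- Real numbers as Cauchy sequences of rationals; _≃ℝ_ is the equality of reals.
record ℝ : Set where
  field
    seq    : ℕ → ℚ
    cauchy : ∀ ε → 0ℚ ℚ.< ε → ∃[ N ] ∀ i j → N ℕ.≤ i → N ℕ.≤ j → ∣ seq i ℚ.- seq j ∣ ℚ.< ε

open ℝ public

infix 4 _≃ℝ_ _≤ℝ_

_≃ℝ_ : ℝ → ℝ → Set
x ≃ℝ y = ∀ ε → 0ℚ ℚ.< ε → ∃[ N ] ∀ i → N ℕ.≤ i → ∣ seq x i ℚ.- seq y i ∣ ℚ.< ε

_≤ℝ_ : ℝ → ℝ → Set
x ≤ℝ y = ∀ ε → 0ℚ ℚ.< ε → ∃[ N ] ∀ i → N ℕ.≤ i → seq x i ℚ.< seq y i ℚ.+ ε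

fromℚ : ℚ → ℝ
fromℚ q = record
  { seq    = λ _ → q
  ; cauchy = λ ε 0<ε → 0 , λ _ _ _ _ → subst (λ d → ∣ d ∣ ℚ.< ε) (sym (ℚ.+-inverseʳ q)) 0<ε
  }

private
  +-rearrange : ∀ a b c d → (a ℚ.+ b) ℚ.- (c ℚ.+ d) ≡ (a ℚ.- c) ℚ.+ (b ℚ.- d)
  +-rearrange = solve 4 (λ a b c d → (a :+ b) :- (c :+ d) := (a :- c) :+ (b :- d)) refl
    where open ℚ.+-*-Solver

  *-rearrange : ∀ a b c d → a ℚ.* b ℚ.- c ℚ.* d ≡ a ℚ.* (b ℚ.- d) ℚ.+ d ℚ.* (a ℚ.- c)
  *-rearrange = solve 4 (λ a b c d → a :* b :- c :* d := a :* (b :- d) :+ d :* (a :- c)) refl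
    where open ℚ.+-*-Solver

  split : ∀ a b → (a ℚ.- b) ℚ.+ b ≡ a
  split = solve 2 (λ a b → (a :- b) :+ b := a) refl
    where open ℚ.+-*-Solver

  ½+½ : ∀ ε → ½ ℚ.* ε ℚ.+ ½ ℚ.* ε ≡ ε
  ½+½ ε = trans (sym (ℚ.*-distribʳ-+ ε ½ ½)) (ℚ.*-identityˡ ε)

  0<*  : ∀ {p q} → 0ℚ ℚ.< p → 0ℚ ℚ.< q → 0ℚ ℚ.< p ℚ.* q
  0<* {p} {q} 0<p 0<q =
    ℚ.positive⁻¹ (p ℚ.* q) {{ℚ.pos*pos⇒pos p {{ℚ.positive 0<p}} q {{ℚ.positive 0<q}}}}

  ½*-pos : ∀ {ε} → 0ℚ ℚ.< ε → 0ℚ ℚ.< ½ ℚ.* ε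
  ½*-pos = 0<* (ℚ.positive⁻¹ ½)

  eventually-bounded : (x : ℝ) →
    ∃[ N ] ∃[ K ] 0ℚ ℚ.< K × (∀ i → N ℕ.≤ i → ∣ seq x i ∣ ℚ.≤ K)
  eventually-bounded x with N , c ← cauchy x 1ℚ (ℚ.positive⁻¹ 1ℚ) =
    N , 1ℚ ℚ.+ ∣ seq x N ∣
      , ℚ.+-mono-<-≤ (ℚ.positive⁻¹ 1ℚ) (ℚ.0≤∣p∣ (seq x N))
      , λ i N≤i → begin
          ∣ seq x i ∣                                  ≡⟨ cong ∣_∣ (split (seq x i) (seq x N)) ⟨
          ∣ (seq x i ℚ.- seq x N) ℚ.+ seq x N ∣        ≤⟨ ℚ.∣p+q∣≤∣p∣+∣q∣ (seq x i ℚ.- seq x N) (seq x N) ⟩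
          ∣ seq x i ℚ.- seq x N ∣ ℚ.+ ∣ seq x N ∣      ≤⟨ ℚ.+-monoˡ-≤ ∣ seq x N ∣ (ℚ.<⇒≤ (c i N N≤i ℕ.≤-refl)) ⟩
          1ℚ ℚ.+ ∣ seq x N ∣                           ∎
    where open ℚ.≤-Reasoning

  sum-close : ∀ {ε} a b c d → ∣ a ℚ.- c ∣ ℚ.< ½ ℚ.* ε → ∣ b ℚ.- d ∣ ℚ.< ½ ℚ.* ε →
    ∣ (a ℚ.+ b) ℚ.- (c ℚ.+ d) ∣ ℚ.< ε
  sum-close {ε} a b c d p q = begin-strict
    ∣ (a ℚ.+ b) ℚ.- (c ℚ.+ d) ∣      ≡⟨ cong ∣_∣ (+-rearrange a b c d) ⟩
    ∣ (a ℚ.- c) ℚ.+ (b ℚ.- d) ∣      ≤⟨ ℚ.∣p+q∣≤∣p∣+∣q∣ (a ℚ.- c) (b ℚ.- d) ⟩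
    ∣ a ℚ.- c ∣ ℚ.+ ∣ b ℚ.- d ∣      <⟨ ℚ.+-mono-< p q ⟩
    ½ ℚ.* ε ℚ.+ ½ ℚ.* ε              ≡⟨ ½+½ ε ⟩
    ε                                ∎
    where open ℚ.≤-Reasoning

  ∣*∣-bound : ∀ {K δ} p q → 0ℚ ℚ.< K → ∣ p ∣ ℚ.≤ K → ∣ q ∣ ℚ.< δ → ∣ p ℚ.* q ∣ ℚ.< K ℚ.* δ
  ∣*∣-bound {K} {δ} p q 0<K p≤K q<δ = begin-strict
    ∣ p ℚ.* q ∣      ≡⟨ ℚ.∣p*q∣≡∣p∣*∣q∣ p q ⟩
    ∣ p ∣ ℚ.* ∣ q ∣  ≤⟨ ℚ.*-monoʳ-≤-nonNeg ∣ q ∣ {{ℚ.∣-∣-nonNeg q}} p≤K ⟩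
    K ℚ.* ∣ q ∣      <⟨ ℚ.*-monoʳ-<-pos K {{ℚ.positive 0<K}} q<δ ⟩
    K ℚ.* δ          ∎
    where open ℚ.≤-Reasoning

  product-close : ∀ {ε K₁ K₂ δ₁ δ₂} a b c d → 0ℚ ℚ.< K₁ → 0ℚ ℚ.< K₂ →
    K₁ ℚ.* δ₁ ≡ ½ ℚ.* ε → K₂ ℚ.* δ₂ ≡ ½ ℚ.* ε →
    ∣ a ∣ ℚ.≤ K₁ → ∣ d ∣ ℚ.≤ K₂ → ∣ b ℚ.- d ∣ ℚ.< δ₁ → ∣ a ℚ.- c ∣ ℚ.< δ₂ →
    ∣ a ℚ.* b ℚ.- c ℚ.* d ∣ ℚ.< ε
  product-close {ε} {K₁} {K₂} {δ₁} {δ₂} a b c d 0<K₁ 0<K₂ e₁ e₂ a≤ d≤ b-d a-c = begin-strict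
    ∣ a ℚ.* b ℚ.- c ℚ.* d ∣                          ≡⟨ cong ∣_∣ (*-rearrange a b c d) ⟩
    ∣ a ℚ.* (b ℚ.- d) ℚ.+ d ℚ.* (a ℚ.- c) ∣          ≤⟨ ℚ.∣p+q∣≤∣p∣+∣q∣ (a ℚ.* (b ℚ.- d)) (d ℚ.* (a ℚ.- c)) ⟩
    ∣ a ℚ.* (b ℚ.- d) ∣ ℚ.+ ∣ d ℚ.* (a ℚ.- c) ∣      <⟨ ℚ.+-mono-< (∣*∣-bound a (b ℚ.- d) 0<K₁ a≤ b-d)
                                                                  (∣*∣-bound d (a ℚ.- c) 0<K₂ d≤ a-c) ⟩
    K₁ ℚ.* δ₁ ℚ.+ K₂ ℚ.* δ₂                          ≡⟨ cong₂ ℚ._+_ e₁ e₂ ⟩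
    ½ ℚ.* ε ℚ.+ ½ ℚ.* ε                              ≡⟨ ½+½ ε ⟩
    ε                                                ∎
    where open ℚ.≤-Reasoning

  divide : ∀ {ε} → 0ℚ ℚ.< ε → ∀ K → 0ℚ ℚ.< K → ∃[ δ ] 0ℚ ℚ.< δ × K ℚ.* δ ≡ ε
  divide {ε} 0<ε K 0<K = ℚ.1/ K ℚ.* ε , 0<* (ℚ.positive⁻¹ (ℚ.1/ K)) 0<ε ,
    trans (sym (ℚ.*-assoc K (ℚ.1/ K) ε))
          (trans (cong (ℚ._* ε) (ℚ.*-inverseʳ K)) (ℚ.*-identityˡ ε))
    where
    instance
      K-pos : ℚ.Positive K
      K-pos = ℚ.positive 0<K
      K-nonZero : ℚ.NonZero K
      K-nonZero = ℚ.pos⇒nonZero K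
      1/K-pos : ℚ.Positive (ℚ.1/ K)
      1/K-pos = ℚ.1/pos⇒pos K

infixl 6 _+ℝ_
infixl 7 _*ℝ_

_+ℝ_ : ℝ → ℝ → ℝ
x +ℝ y = record
  { seq    = λ i → seq x i ℚ.+ seq y i
  ; cauchy = λ ε 0<ε →
      let N₁ , c₁ = cauchy x (½ ℚ.* ε) (½*-pos 0<ε)
          N₂ , c₂ = cauchy y (½ ℚ.* ε) (½*-pos 0<ε)
      in N₁ ℕ.⊔ N₂ , λ i j N≤i N≤j →
        sum-close (seq x i) (seq y i) (seq x j) (seq y j)
          (c₁ i j (ℕ.m⊔n≤o⇒m≤o N₁ N₂ N≤i) (ℕ.m⊔n≤o⇒m≤o N₁ N₂ N≤j))
          (c₂ i j (ℕ.m⊔n≤o⇒n≤o N₁ N₂ N≤i) (ℕ.m⊔n≤o⇒n≤o N₁ N₂ N≤j))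
  }

_*ℝ_ : ℝ → ℝ → ℝ
x *ℝ y = record
  { seq    = λ i → seq x i ℚ.* seq y i
  ; cauchy = λ ε 0<ε →
      let M₁ , K₁ , 0<K₁ , b₁ = eventually-bounded x
          M₂ , K₂ , 0<K₂ , b₂ = eventually-bounded y
          δ₁ , 0<δ₁ , e₁ = divide (½*-pos 0<ε) K₁ 0<K₁
          δ₂ , 0<δ₂ , e₂ = divide (½*-pos 0<ε) K₂ 0<K₂
          N₁ , c₁ = cauchy x δ₂ 0<δ₂
          N₂ , c₂ = cauchy y δ₁ 0<δ₁
          M = M₁ ℕ.⊔ M₂
          N = N₁ ℕ.⊔ N₂
      in M ℕ.⊔ N , λ i j ≤i ≤j →
        let M≤i = ℕ.m⊔n≤o⇒m≤o M N ≤i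
            M≤j = ℕ.m⊔n≤o⇒m≤o M N ≤j
            N≤i = ℕ.m⊔n≤o⇒n≤o M N ≤i
            N≤j = ℕ.m⊔n≤o⇒n≤o M N ≤j
        in product-close (seq x i) (seq y i) (seq x j) (seq y j) 0<K₁ 0<K₂ e₁ e₂
             (b₁ i (ℕ.m⊔n≤o⇒m≤o M₁ M₂ M≤i))
             (b₂ j (ℕ.m⊔n≤o⇒n≤o M₁ M₂ M≤j))
             (c₂ i j (ℕ.m⊔n≤o⇒n≤o N₁ N₂ N≤i) (ℕ.m⊔n≤o⇒n≤o N₁ N₂ N≤j))
             (c₁ i j (ℕ.m⊔n≤o⇒m≤o N₁ N₂ N≤i) (ℕ.m⊔n≤o⇒m≤o N₁ N₂ N≤j))
  }

sumℝ productℝ : List ℝ → ℝ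
sumℝ     = foldr _+ℝ_ (fromℚ 0ℚ)
productℝ = foldr _*ℝ_ (fromℚ 1ℚ)

-- λ_H(B(a)), as the polynomial Σ_f Π_{i ∈ V(H)} a_{f(i)} over colour-respecting
-- maps f : V(H) → V(B).
blowupDensity : ∀ {κ m} → ColouredGraph κ → Graph m → (Fin m → ℝ) → ℝ
blowupDensity {κ} {m} H B a =
  sumℝ (map (λ f → productℝ (map (λ i → a (lookup f i)) (allFin κ)))
           (filter (λ f → respectsColours? H B (lookup f)) (allMaps κ m)))

InSimplex : ∀ {m} → (Fin m → ℝ) → Set
InSimplex {m} a = (∀ i → fromℚ 0ℚ ≤ℝ a i) × sumℝ (map a (allFin m)) ≃ℝ fromℚ 1ℚ

IsMaximizer : ∀ {κ m} → ColouredGraph κ → Graph m → (Fin m → ℝ) → Set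
IsMaximizer H B a =
  InSimplex a × (∀ b → InSimplex b → blowupDensity H B b ≤ℝ blowupDensity H B a)

IsUniqueMaximizer : ∀ {κ m} → ColouredGraph κ → Graph m → (Fin m → ℝ) → Set
IsUniqueMaximizer H B a =
  IsMaximizer H B a × (∀ b → IsMaximizer H B b → ∀ i → b i ≃ℝ a i)

H₄ : ColouredGraph 4
H₄ = record
  { red      = R
  ; blue     = S
  ; disjoint = from-yes (Fin.all? λ u → Fin.all? λ v → (adj R u v ∧ adj S u v) Bool.≟ false)
  }
  where
  R S : Graph 4
  R = fromEdges ((0F , 2F) ∷ (0F , 3F) ∷ [])
  S = fromEdges ((0F , 1F) ∷ (2F , 3F) ∷ [])

K₂ : Graph 2
K₂ = completeGraph 2

{-# OPTIONS --safe #-}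

-- Write p and q for the degrees of the ends of an edge xz, s for the number of their common
-- neighbours and r for the number of their common non-neighbours, so that r − s = n − p − q.
-- An embedding of H₄ is an edge xz together with a non-neighbour y of x and a neighbour w of x
-- that is not adjacent to z; there are p − 1 − s choices of w, so the two orientations of an
-- edge carry (n − 1 − p)(p − 1 − s) + (n − 1 − q)(q − 1 − s) embeddings.  This is at most
-- ω(p) + ω(q) for a weight ω with p ω(p) bounded by a constant, and summing over the edges
-- gives the number of embeddings into the balanced complete bipartite graph as upper bound.
-- For large n every edge even leaves a slack of order n (r + s).  The sum of r + s over the
-- edges counts the triples of vertices spanning an odd number of edges, and a pair of vertices
-- on which G differs from the complete bipartite graph with parts N(x) and its complement
-- forms such a triple with x.  Averaging over x gives the stability.
--
-- On K₂ the density is 2x²y², and (x + y)⁴ − 16x²y² = (x − y)² ((x + y)² + 4xy).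

module Submission where

open import Defs
open import Data.Integer.Base using (+_)
open import Data.Product.Base using (_×_)
open import Data.Rational.Base using (½; _/_)

open import Data.Bool.Base using (Bool; true; false; T; _∧_; not; if_then_else_)
import Data.Bool.Properties as Bool
open import Data.Fin.Base using (Fin; zero; suc; toℕ)
open import Data.Fin.Patterns using (0F; 1F; 2F; 3F)
import Data.Fin.Permutation as Perm
import Data.Fin.Properties as Fin
import Data.Integer.Base as ℤ
import Data.Integer.Properties as ℤ
open import Data.Integer.Tactic.RingSolver using (solve-∀)
open import Data.List.Base
  using (List; []; _∷_; _++_; map; filter; length; allFin; tabulate; cartesianProduct; cartesianProductWith)
import Data.List.Extrema as Extrema
import Data.List.Membership.DecPropositional as DecMembership
open import Data.List.Membership.Propositional using (_∈_)
open import Data.List.Membership.Propositional.Properties using (∈-allFin)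
import Data.List.Relation.Unary.All as All
open import Data.List.Relation.Unary.Any using (here; there)
open import Data.Nat.Base as ℕ using (ℕ; zero; suc)
open import Data.Nat.Combinatorics.Base using (_P′_)
import Data.Nat.Properties as ℕ
open import Data.Product.Base using (Σ-syntax; ∃-syntax; _,_; map₂; proj₁; proj₂)
open import Data.Product.Properties using (≡-dec)
open import Data.Rational.Solver using (module +-*-Solver)
import Data.Rational.Unnormalised.Base as ℚᵘ
import Data.Rational.Unnormalised.Properties as ℚᵘ
open import Data.Sum.Base using (_⊎_; inj₁; inj₂)
open import Data.Vec.Base using (Vec; []; _∷_; lookup)
open import Data.Vec.Relation.Unary.All using ([]; _∷_)
open import Data.Vec.Relation.Unary.AllPairs using ([]; _∷_)
import Data.Vec.Relation.Unary.Unique.Propositional.Properties as Unique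
open import Function.Base using (_∘_; id)
open import Function.Bundles using (_⇔_; mk⇔)
open import Relation.Binary.Bundles using (DecTotalOrder)
open import Relation.Binary.PropositionalEquality hiding ([_])
open import Relation.Nullary.Decidable
  using (Dec; yes; no; does; _×-dec_; ¬?; does-⇔; dec-true)
open import Relation.Nullary.Negation using (¬_; contradiction)
open import Relation.Unary using (Decidable; Pred)

module Counting where

  open import Algebra.Properties.Semiring.Sum ℤ.+-*-semiring
    using (sum; sum-syntax; sum-cong-≗; ∑-distrib-+; ∑-comm; *-distribˡ-sum; *-distribʳ-sum)
  open import Data.Integer.Base hiding (suc; _/_)
  open import Data.Integer.Properties

  -- Integer inequalities for a single edge

  infixl 6 _⊕_
  infixl 7 _⊗_

  _⊕_ : ∀ {x y} → 0ℤ ≤ x → 0ℤ ≤ y → 0ℤ ≤ x + y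
  _⊕_ = +-mono-≤

  _⊗_ : ∀ {x y} → 0ℤ ≤ x → 0ℤ ≤ y → 0ℤ ≤ x * y
  _⊗_ {+ x} {+ y} _ _ = subst (0ℤ ≤_) (pos-* x y) (+≤+ ℕ.z≤n)

  square≥0 : ∀ x → 0ℤ ≤ x * x
  square≥0 (+ x)    = subst (0ℤ ≤_) (pos-* x x) (+≤+ ℕ.z≤n)
  square≥0 -[1+ x ] = +≤+ ℕ.z≤n

  num : ∀ k → 0ℤ ≤ + k
  num k = +≤+ ℕ.z≤n

  consecutive≥0 : ∀ x → 0ℤ ≤ x * (x - 1ℤ)
  consecutive≥0 (+ zero)  = ≤-refl
  consecutive≥0 (+ suc x) = num (suc x) ⊗ num x
  consecutive≥0 -[1+ x ]  = +≤+ ℕ.z≤n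

  -- Polynomial inequalities below are proved by certificates: a visibly nonnegative expression that
  -- the ring solver identifies with the difference of the two sides.
  ≤-by : ∀ {x y z} → 0ℤ ≤ z → z ≡ y - x → x ≤ y
  ≤-by 0≤z eq = 0≤i-j⇒j≤i (subst (0ℤ ≤_) eq 0≤z)

  Balanced : ℤ → ℤ → Set
  Balanced a b = b ≡ a ⊎ b ≡ a + 1ℤ

  -- For x = a + d the loss is d² or d (d - 1). The latter is nonnegative because d is an integer;
  -- this is how odd orders are handled.
  balanced-product-max : ∀ {a b} → Balanced a b → ∀ x → x * (a + b - x) ≤ a * b
  balanced-product-max {a} (inj₁ refl) x = ≤-by (square≥0 (x - a)) (lemma a x)
    where
    lemma : ∀ a x → (x - a) * (x - a) ≡ a * a - x * (a + a - x)
    lemma = solve-∀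
  balanced-product-max {a} (inj₂ refl) x = ≤-by (consecutive≥0 (x - a)) (lemma a x)
    where
    lemma : ∀ a x → (x - a) * (x - a - 1ℤ) ≡ a * (a + 1ℤ) - x * (a + (a + 1ℤ) - x)
    lemma = solve-∀

  -- With n = a + b for a and b as equal as possible, ν = a b and μ = (a − 1)(b − 1), the graph
  -- K_{a,b} has 2 ν μ embeddings; p and q are degrees, s is a number of common neighbours.

  gap : ℤ → ℤ → ℤ → ℤ
  gap n ν p = ν - p * (n - p)

  -- The share of p is μ (n (n − p) + gap); its product with p is at most n μ ν since p ≤ n.
  -- The linear part alone has too little slack for degrees close to n.
  edge-weight : ℤ → ℤ → ℤ → ℤ → ℤ → ℤ
  edge-weight n ν μ p q = μ * (n * (+ 2 * n - p - q) + gap n ν p + gap n ν q)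

  edge-count : ℤ → ℤ → ℤ → ℤ → ℤ
  edge-count n p q s = (n - 1ℤ - p) * (p - 1ℤ - s) + (n - 1ℤ - q) * (q - 1ℤ - s)

  -- Collects what the edge inequalities use about a and b, so that both parities of n are covered
  -- by the same identities. The loss of 1 in the lower bounds is attained for odd n, and `large`
  -- keeps the lower-order terms of the certificates nonnegative.
  record Typical (n ν μ : ℤ) : Set where
    field
      large   : + 20 ≤ n
      ν-lower : n * n - 1ℤ ≤ + 4 * ν
      μ-lower : (n - + 2) * (n - + 2) - 1ℤ ≤ + 4 * μ
      ν-max   : ∀ x → x * (n - x) ≤ ν
      μ-max   : ∀ x → x * (n - + 2 - x) ≤ μ
      μ≥0     : 0ℤ ≤ μ

  module _ {n ν μ} (T : Typical n ν μ) where
    open Typical T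

    -- Here r + s = (n - p - q) + 2 s. By `μ-max` at p - 1 and q - 1 the count is at most 2 μ - s (2
    -- n - 2 - p - q), while the linear part of the weight is n² μ + n μ (n - p - q). After scaling,
    -- both s and n - p - q carry a gain of order n³, which pays for n³ (r + s).
    edge-inequality-sparse : ∀ p q s → 0ℤ ≤ s → 0ℤ ≤ n - p - q →
      + 64 * (n * n * edge-count n p q s) + n * n * n * ((n - p - q) + + 2 * s)
        ≤ + 128 * edge-weight n ν μ p q
    edge-inequality-sparse p q s 0≤s 0≤i = ≤-by
      (num 64 ⊗ nn ⊗ (i≤j⇒0≤j-i (μ-max (p - 1ℤ)) ⊕ i≤j⇒0≤j-i (μ-max (q - 1ℤ)))
        ⊕ num 128 ⊗ μ≥0 ⊗ (i≤j⇒0≤j-i (ν-max p) ⊕ i≤j⇒0≤j-i (ν-max q))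
        ⊕ num 64 ⊗ nn ⊗ 0≤s ⊗ 0≤i
        ⊕ nn ⊗ 0≤s ⊗ (num 62 ⊗ m ⊕ num 1112)
        ⊕ 0≤n ⊗ 0≤i ⊗ (num 32 ⊗ i≤j⇒0≤j-i μ-lower ⊕ (m ⊗ (num 31 ⊗ 0≤n ⊕ num 492) ⊕ num 9936)))
      (identity n ν μ p q s)
      where
      m = i≤j⇒0≤j-i large
      0≤n = ≤-trans (num 20) large
      nn = 0≤n ⊗ 0≤n
      identity : ∀ n ν μ p q s →
        + 64 * (n * n) * ((μ - (p - 1ℤ) * (n - + 2 - (p - 1ℤ))) + (μ - (q - 1ℤ) * (n - + 2 - (q - 1ℤ))))
        + + 128 * μ * ((ν - p * (n - p)) + (ν - q * (n - q)))
        + + 64 * (n * n) * s * (n - p - q)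
        + n * n * s * (+ 62 * (n - + 20) + + 1112)
        + n * (n - p - q) * (+ 32 * (+ 4 * μ - ((n - + 2) * (n - + 2) - 1ℤ)) + ((n - + 20) * (+ 31 * n + + 492) + + 9936))
        ≡ + 128 * (μ * (n * (+ 2 * n - p - q) + (ν - p * (n - p)) + (ν - q * (n - q))))
          - (+ 64 * (n * n * ((n - 1ℤ - p) * (p - 1ℤ - s) + (n - 1ℤ - q) * (q - 1ℤ - s))) + n * n * n * ((n - p - q) + + 2 * s))
      identity = solve-∀

    -- For 2 (p + q − n) ≤ n the linear part of the weight suffices; beyond, the slack comes
    -- from the gaps.
    edge-inequality-dense : ∀ p q r → 0ℤ ≤ r → r ≤ n - 1ℤ - p → r ≤ n - 1ℤ - q → 1ℤ ≤ p + q - n →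
      + 64 * (n * n * edge-count n p q (r + (p + q - n))) + n * n * n * (+ 2 * r + (p + q - n))
        ≤ + 128 * edge-weight n ν μ p q
    edge-inequality-dense p q r 0≤r r≤₁ r≤₂ 1≤j with ≤-total (+ 2 * (p + q - n)) n
    ... | inj₁ 2j≤n = ≤-by
      (num 16 ⊗ 0≤n ⊗ (0≤n ⊕ 0≤h) ⊗ 0≤h₁
        ⊕ num 32 ⊗ nn ⊗ square≥0 (p - q)
        ⊕ num 128 ⊗ μ≥0 ⊗ (i≤j⇒0≤j-i (ν-max p) ⊕ i≤j⇒0≤j-i (ν-max q))
        ⊕ nn ⊗ 0≤r ⊗ (num 32 ⊗ 0≤h ⊕ (num 30 ⊗ m ⊕ num 472))
        ⊕ num 16 ⊗ nn ⊗ (h₃ ⊕ num 1) ⊗ 0≤h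
        ⊕ 0≤n ⊗ (h₃ ⊗ (m ⊗ (num 15 ⊗ 0≤n ⊕ num 300) ⊕ num 5904)
                  ⊕ (m ⊗ (num 15 ⊗ 0≤n ⊕ num 268) ⊕ num 5264)))
      (identity n ν μ p q r)
      where
      m = i≤j⇒0≤j-i large
      0≤n = ≤-trans (num 20) large
      nn = 0≤n ⊗ 0≤n
      0≤h = i≤j⇒0≤j-i 2j≤n
      0≤h₁ = i≤j⇒0≤j-i μ-lower
      h₃ = i≤j⇒0≤j-i 1≤j
      identity : ∀ n ν μ p q r →
        + 16 * n * (n + (n - + 2 * (p + q - n))) * (+ 4 * μ - ((n - + 2) * (n - + 2) - 1ℤ))
        + + 32 * (n * n) * ((p - q) * (p - q))
        + + 128 * μ * ((ν - p * (n - p)) + (ν - q * (n - q)))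
        + n * n * r * (+ 32 * (n - + 2 * (p + q - n)) + (+ 30 * (n - + 20) + + 472))
        + + 16 * (n * n) * (p + q - n - 1ℤ + 1ℤ) * (n - + 2 * (p + q - n))
        + n * ((p + q - n - 1ℤ) * ((n - + 20) * (+ 15 * n + + 300) + + 5904)
               + ((n - + 20) * (+ 15 * n + + 268) + + 5264))
        ≡ + 128 * (μ * (n * (+ 2 * n - p - q) + (ν - p * (n - p)) + (ν - q * (n - q))))
          - (+ 64 * (n * n * ((n - 1ℤ - p) * (p - 1ℤ - (r + (p + q - n))) + (n - 1ℤ - q) * (q - 1ℤ - (r + (p + q - n)))))
             + n * n * n * (+ 2 * r + (p + q - n)))
      identity = solve-∀
    -- Twice the sum of the two gaps is 4 ν - n² + (p + q - n)² + (p - q)². Since p + q - n is at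
    -- least n / 2 here, its square contributes a slack of order n⁴ after multiplication by μ.
    ... | inj₂ n≤2j = ≤-by
      (num 32 ⊗ 0≤n ⊗ (w ⊕ num 2) ⊗ 0≤h₁
        ⊕ num 32 ⊗ nn ⊗ square≥0 (p - q)
        ⊕ num 64 ⊗ μ≥0 ⊗ (i≤j⇒0≤j-i ν-lower ⊕ square≥0 (p - q))
        ⊕ num 16 ⊗ 0≤h₁ ⊗ h₃ ⊗ (h₃ ⊕ num 2)
        ⊕ num 4 ⊗ (m ⊕ num 19) ⊗ (m ⊕ num 17) ⊗ 0≤h ⊗ (0≤h ⊕ num 2 ⊗ 0≤n)
        ⊕ (m ⊕ num 18) ⊗ (m ⊗ (num 3 ⊗ nn ⊕ num 52 ⊗ 0≤n ⊕ num 1020) ⊕ num 20424)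
        ⊕ nn ⊗ 0≤n ⊗ (i≤j⇒0≤j-i r≤₁ ⊕ i≤j⇒0≤j-i r≤₂)
        ⊕ num 64 ⊗ nn ⊗ 0≤r ⊗ w
        ⊕ num 32 ⊗ 0≤n ⊗ ((h₃ ⊕ num 1) ⊗ 0≤n ⊗ w ⊕ h₃ ⊗ (num 2 ⊗ m ⊕ num 37) ⊕ (m ⊕ num 17)))
      (identity n ν μ p q r)
      where
      m = i≤j⇒0≤j-i large
      0≤n = ≤-trans (num 20) large
      nn = 0≤n ⊗ 0≤n
      0≤h = i≤j⇒0≤j-i n≤2j
      0≤h₁ = i≤j⇒0≤j-i μ-lower
      h₃ = i≤j⇒0≤j-i 1≤j
      w = ≤-trans 0≤r r≤₁ ⊕ ≤-trans 0≤r r≤₂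
      identity : ∀ n ν μ p q r →
        + 32 * n * ((n - 1ℤ - p) + (n - 1ℤ - q) + + 2) * (+ 4 * μ - ((n - + 2) * (n - + 2) - 1ℤ))
        + + 32 * (n * n) * ((p - q) * (p - q))
        + + 64 * μ * (+ 4 * ν - (n * n - 1ℤ) + (p - q) * (p - q))
        + + 16 * (+ 4 * μ - ((n - + 2) * (n - + 2) - 1ℤ)) * (p + q - n - 1ℤ) * (p + q - n - 1ℤ + + 2)
        + + 4 * (n - + 20 + + 19) * (n - + 20 + + 17) * (+ 2 * (p + q - n) - n) * (+ 2 * (p + q - n) - n + + 2 * n)
        + (n - + 20 + + 18) * ((n - + 20) * (+ 3 * (n * n) + + 52 * n + + 1020) + + 20424)
        + n * n * n * ((n - 1ℤ - p - r) + (n - 1ℤ - q - r))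
        + + 64 * (n * n) * r * ((n - 1ℤ - p) + (n - 1ℤ - q))
        + + 32 * n * ((p + q - n - 1ℤ + 1ℤ) * n * ((n - 1ℤ - p) + (n - 1ℤ - q))
            + (p + q - n - 1ℤ) * (+ 2 * (n - + 20) + + 37) + (n - + 20 + + 17))
        ≡ + 128 * (μ * (n * (+ 2 * n - p - q) + (ν - p * (n - p)) + (ν - q * (n - q))))
          - (+ 64 * (n * n * ((n - 1ℤ - p) * (p - 1ℤ - (r + (p + q - n))) + (n - 1ℤ - q) * (q - 1ℤ - (r + (p + q - n)))))
             + n * n * n * (+ 2 * r + (p + q - n)))
      identity = solve-∀

    -- The sign of r - s = n - p - q selects the case, and the smaller of the two counts stays as
    -- the free variable: s if the sign is nonnegative, r otherwise.
    edge-inequality : ∀ p q r s → 0ℤ ≤ r → 0ℤ ≤ s → r ≡ n - p - q + s →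
      r ≤ n - 1ℤ - p → r ≤ n - 1ℤ - q →
      + 64 * (n * n * edge-count n p q s) + n * n * n * (r + s) ≤ + 128 * edge-weight n ν μ p q
    edge-inequality p q r s 0≤r 0≤s r≡ r≤₁ r≤₂ with 0ℤ ≤? (n - p - q)
    ... | yes 0≤i = subst (λ z → + 64 * (n * n * edge-count n p q s) + n * n * n * z ≤ + 128 * edge-weight n ν μ p q)
                       (trans (lemma (n - p - q) s) (cong (_+ s) (sym r≡)))
                       (edge-inequality-sparse p q s 0≤s 0≤i)
      where
      lemma : ∀ i s → i + + 2 * s ≡ i + s + s
      lemma = solve-∀
    ... | no 0≰i = subst₂ (λ z z′ → + 64 * (n * n * edge-count n p q z) + n * n * n * z′ ≤ + 128 * edge-weight n ν μ p q)
                       (sym s≡) (trans (lemma₂ r (p + q - n)) (cong (_+_ r) (sym s≡)))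
                       (edge-inequality-dense p q r 0≤r r≤₁ r≤₂ (≤-by (i≤j⇒0≤j-i (i<j⇒suc[i]≤j (≰⇒> 0≰i))) (lemma₃ n p q)))
      where
      lemma₁ : ∀ n p q s → s ≡ n - p - q + s + (p + q - n)
      lemma₁ = solve-∀
      s≡ : s ≡ r + (p + q - n)
      s≡ = trans (lemma₁ n p q s) (cong (_+ (p + q - n)) (sym r≡))
      lemma₂ : ∀ r j → + 2 * r + j ≡ r + (r + j)
      lemma₂ = solve-∀
      lemma₃ : ∀ n p q → 0ℤ - (1ℤ + (n - p - q)) ≡ p + q - n - 1ℤ
      lemma₃ = solve-∀

  -- The pair a - 1, b - 1 is again balanced and has sum n - 2, so the bounds on μ are those on ν
  -- for this pair.
  balanced-typical : ∀ {a b} → Balanced a b → + 20 ≤ a + b → Typical (a + b) (a * b) ((a - 1ℤ) * (b - 1ℤ))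
  balanced-typical {a} {b} bal 20≤n = record
    { large   = 20≤n
    ; ν-lower = ν-lower bal
    ; μ-lower = μ-lower
    ; ν-max   = balanced-product-max bal
    ; μ-max   = μ-max
    ; μ≥0     = ≤-trans (≤-reflexive (lemma₂ a b)) (μ-max 0ℤ)
    }
    where
    ν-lower : ∀ {a b} → Balanced a b → (a + b) * (a + b) - 1ℤ ≤ + 4 * (a * b)
    ν-lower {a} (inj₁ refl) = ≤-by (num 1) (lemma a)
      where
      lemma : ∀ a → 1ℤ ≡ + 4 * (a * a) - ((a + a) * (a + a) - 1ℤ)
      lemma = solve-∀
    ν-lower {a} (inj₂ refl) = ≤-reflexive (lemma a)
      where
      lemma : ∀ a → (a + (a + 1ℤ)) * (a + (a + 1ℤ)) - 1ℤ ≡ + 4 * (a * (a + 1ℤ))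
      lemma = solve-∀

    shift : ∀ {a b} → Balanced a b → Balanced (a - 1ℤ) (b - 1ℤ)
    shift (inj₁ refl) = inj₁ refl
    shift {a} (inj₂ refl) = inj₂ (lemma a)
      where
      lemma : ∀ a → a + 1ℤ - 1ℤ ≡ a - 1ℤ + 1ℤ
      lemma = solve-∀

    lemma₁ : ∀ a b → a - 1ℤ + (b - 1ℤ) ≡ a + b - + 2
    lemma₁ = solve-∀

    lemma₂ : ∀ a b → 0ℤ ≡ 0ℤ * (a + b - + 2 - 0ℤ)
    lemma₂ = solve-∀

    μ-lower : (a + b - + 2) * (a + b - + 2) - 1ℤ ≤ + 4 * ((a - 1ℤ) * (b - 1ℤ))
    μ-lower = subst (λ z → z * z - 1ℤ ≤ + 4 * ((a - 1ℤ) * (b - 1ℤ))) (lemma₁ a b) (ν-lower (shift bal))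

    μ-max : ∀ x → x * (a + b - + 2 - x) ≤ (a - 1ℤ) * (b - 1ℤ)
    μ-max x = subst (λ z → x * (z - x) ≤ (a - 1ℤ) * (b - 1ℤ)) (lemma₁ a b) (balanced-product-max (shift bal) x)

  -- Counting by sums of indicators

  ⟦_⟧ : Bool → ℤ
  ⟦ true  ⟧ = 1ℤ
  ⟦ false ⟧ = 0ℤ

  ⟦∧⟧ : ∀ b c → ⟦ b ∧ c ⟧ ≡ ⟦ b ⟧ * ⟦ c ⟧
  ⟦∧⟧ true  c = sym (*-identityˡ ⟦ c ⟧)
  ⟦∧⟧ false c = refl

  ⟦⟧≥0 : ∀ b → 0ℤ ≤ ⟦ b ⟧
  ⟦⟧≥0 true  = num 1
  ⟦⟧≥0 false = num 0

  ∑-cong : ∀ n {f g : Fin n → ℤ} → f ≗ g → sum f ≡ sum g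
  ∑-cong n = sum-cong-≗

  ∑-mono : ∀ n {f g : Fin n → ℤ} → (∀ i → f i ≤ g i) → sum f ≤ sum g
  ∑-mono zero    f≤g = ≤-refl
  ∑-mono (suc n) f≤g = +-mono-≤ (f≤g zero) (∑-mono n (f≤g ∘ suc))

  ∑-const : ∀ n c → ∑[ i < n ] c ≡ + n * c
  ∑-const zero    c = refl
  ∑-const (suc n) c = trans (cong (_+_ c) (∑-const n c)) (sym (suc-* (+ n) c))

  ∑-zero : ∀ n → ∑[ i < n ] 0ℤ ≡ 0ℤ
  ∑-zero n = trans (∑-const n 0ℤ) (*-zeroʳ (+ n))

  ∑-nonneg : ∀ n {f : Fin n → ℤ} → (∀ i → 0ℤ ≤ f i) → 0ℤ ≤ sum f
  ∑-nonneg n {f} 0≤f = subst (_≤ sum f) (∑-zero n) (∑-mono n 0≤f)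

  ∑-diagonal : ∀ {n} (u : Fin n) → ∑[ v < n ] ⟦ does (u Fin.≟ v) ⟧ ≡ 1ℤ
  ∑-diagonal {suc n} zero    = cong (_+_ 1ℤ) (∑-zero n)
  ∑-diagonal {suc n} (suc u) = trans (+-identityˡ _) (∑-diagonal u)

  listSum : ∀ {A : Set} → (A → ℤ) → List A → ℤ
  listSum f []       = 0ℤ
  listSum f (x ∷ xs) = f x + listSum f xs

  length-filter : ∀ {A : Set} {p} {P : Pred A p} (P? : Decidable P) xs →
    + length (filter P? xs) ≡ listSum (λ x → ⟦ does (P? x) ⟧) xs
  length-filter P? []       = refl
  length-filter P? (x ∷ xs) with does (P? x)
  ... | true  = cong (_+_ 1ℤ) (length-filter P? xs)
  ... | false = trans (length-filter P? xs) (sym (+-identityˡ _))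

  listSum-++ : ∀ {A : Set} (f : A → ℤ) xs ys → listSum f (xs ++ ys) ≡ listSum f xs + listSum f ys
  listSum-++ f []       ys = sym (+-identityˡ _)
  listSum-++ f (x ∷ xs) ys = trans (cong (_+_ (f x)) (listSum-++ f xs ys)) (sym (+-assoc (f x) _ _))

  listSum-map : ∀ {A B : Set} f (g : B → A) xs → listSum f (map g xs) ≡ listSum (f ∘ g) xs
  listSum-map f g []       = refl
  listSum-map f g (x ∷ xs) = cong (_+_ (f (g x))) (listSum-map f g xs)

  listSum-tabulate : ∀ {A : Set} n (f : A → ℤ) (g : Fin n → A) → listSum f (tabulate g) ≡ sum (f ∘ g)
  listSum-tabulate zero    f g = refl
  listSum-tabulate (suc n) f g = cong (_+_ (f (g zero))) (listSum-tabulate n f (g ∘ suc))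

  listSum-cartesianProductWith : ∀ {A B C : Set} f (g : A → B → C) xs ys →
    listSum f (cartesianProductWith g xs ys) ≡ listSum (λ x → listSum (f ∘ g x) ys) xs
  listSum-cartesianProductWith f g []       ys = refl
  listSum-cartesianProductWith f g (x ∷ xs) ys =
    trans (listSum-++ f (map (g x) ys) _)
          (cong₂ _+_ (listSum-map f (g x) ys) (listSum-cartesianProductWith f g xs ys))

  listSum-pairs : ∀ n (f : Fin n × Fin n → ℤ) →
    listSum f (cartesianProduct (allFin n) (allFin n)) ≡ ∑[ u < n ] ∑[ v < n ] f (u , v)
  listSum-pairs n f =
    trans (listSum-cartesianProductWith f _,_ (allFin n) (allFin n))
          (trans (listSum-tabulate n (λ u → listSum (f ∘ (u ,_)) (allFin n)) id)
                 (∑-cong n λ u → listSum-tabulate n (f ∘ (u ,_)) id))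

  listSum-allMaps : ∀ k n f →
    listSum f (allMaps (suc k) n) ≡ ∑[ i < n ] listSum (f ∘ (i ∷_)) (allMaps k n)
  listSum-allMaps k n f =
    trans (listSum-cartesianProductWith f _∷_ (allFin n) (allMaps k n))
          (listSum-tabulate n (λ i → listSum (f ∘ (i ∷_)) (allMaps k n)) id)

  count-maps₄ : ∀ {n p} {P : Pred (Vec (Fin n) 4) p} (P? : Decidable P) →
    + length (filter P? (allMaps 4 n)) ≡
    ∑[ x < n ] ∑[ y < n ] ∑[ z < n ] ∑[ w < n ] ⟦ does (P? (x ∷ y ∷ z ∷ w ∷ [])) ⟧
  count-maps₄ {n} P? = trans (length-filter P? (allMaps 4 n))
    (trans (listSum-allMaps 3 n _) (∑-cong n λ x →
     trans (listSum-allMaps 2 n _) (∑-cong n λ y →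
     trans (listSum-allMaps 1 n _) (∑-cong n λ z →
     trans (listSum-allMaps 0 n _) (∑-cong n λ w → +-identityʳ _)))))

  -- Leaves only the listed edges of `H₄` and their reverses to be checked in `embedding⇔`, in place
  -- of all pairs of vertices.
  fromEdges-∈ : ∀ {n} (es : List (Fin n × Fin n)) u v →
    adj (fromEdges es) u v ≡ true → (u , v) ∈ es ⊎ (v , u) ∈ es
  fromEdges-∈ es u v e with u Fin.≟ v | (u , v) ∈? es | (v , u) ∈? es
    where open DecMembership (≡-dec Fin._≟_ Fin._≟_) using (_∈?_)
  ... | no _ | yes uv∈ | _       = inj₁ uv∈
  ... | no _ | no _    | yes vu∈ = inj₂ vu∈

  below-average : ∀ {n} .{{_ : ℕ.NonZero n}} (f : Fin n → ℤ) → ∃[ i ] + n * f i ≤ sum f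
  below-average {suc n} f = i , (begin
    + suc n * f i        ≡⟨ ∑-const (suc n) (f i) ⟨
    ∑[ j < suc n ] f i   ≤⟨ ∑-mono (suc n) (λ j → All.lookup (f[argmin]≤f[xs] {f = f} zero (allFin _)) (∈-allFin j)) ⟩
    sum f                ∎)
    where
    open ≤-Reasoning
    open Extrema ≤-totalOrder using (argmin; f[argmin]≤f[xs])
    i = argmin f zero (allFin _)

  side : Bool → Fin 2
  side b = if b then 1F else 0F

  -- Embeddings and degree counts in a fixed graph

  module _ {n} (G : Graph n) where

    infix 4 _~_ _≁_

    _~_ _≁_ : Fin n → Fin n → Set
    u ~ v = adj G u v ≡ true
    u ≁ v = ¬ (u ≡ v) × adj G u v ≡ false

    _~?_ : ∀ u v → Dec (u ~ v)
    u ~? v = adj G u v Bool.≟ true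

    _≁?_ : ∀ u v → Dec (u ≁ v)
    u ≁? v = ¬? (u Fin.≟ v) ×-dec (adj G u v Bool.≟ false)

    -- Injectivity is contained in the four conditions: adjacency separates x from z and w, `≁`
    -- separates x from y and z from w, and y differs from z and w because these are neighbours of x
    -- and y is not.
    embedding⇔ : ∀ x y z w → IsEmbedding H₄ G (lookup (x ∷ y ∷ z ∷ w ∷ [])) ⇔
      (x ~ z × x ~ w × x ≁ y × z ≁ w)
    embedding⇔ x y z w = mk⇔ to from
      where
      f = lookup (x ∷ y ∷ z ∷ w ∷ [])

      to : IsEmbedding H₄ G f → x ~ z × x ~ w × x ≁ y × z ≁ w
      to (inj , red , blue) =
          red 0F 2F refl
        , red 0F 3F refl
        , ((λ x≡y → Fin.0≢1+n (inj {0F} {1F} x≡y)) , blue 0F 1F refl)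
        , ((λ z≡w → Fin.0≢1+n (Fin.suc-injective (Fin.suc-injective (inj {2F} {3F} z≡w)))) , blue 2F 3F refl)

      ~⇒≢ : ∀ {u v} → u ~ v → u ≢ v
      ~⇒≢ {u} e refl with () ← trans (sym e) (adj-irr G u)

      from : x ~ z × x ~ w × x ≁ y × z ≁ w → IsEmbedding H₄ G f
      from (xz , xw , (x≢y , xy) , (z≢w , zw)) =
        (λ {i} {j} → Unique.lookup-injective distinct i j) , red-edges , blue-edges
        where
        distinct = (x≢y ∷ ~⇒≢ xz ∷ ~⇒≢ xw ∷ [])
                 ∷ ((λ { refl → contra xz xy }) ∷ (λ { refl → contra xw xy }) ∷ [])
                 ∷ (z≢w ∷ []) ∷ [] ∷ []
          where
          contra : ∀ {u} → x ~ u → adj G x u ≡ false → _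
          contra e e′ with () ← trans (sym e) e′

        red-edges : ∀ i j → adj (ColouredGraph.red H₄) i j ≡ true → adj G (f i) (f j) ≡ true
        red-edges i j e with fromEdges-∈ ((0F , 2F) ∷ (0F , 3F) ∷ []) i j e
        ... | inj₁ (here refl)         = xz
        ... | inj₁ (there (here refl)) = xw
        ... | inj₂ (here refl)         = trans (adj-sym G z x) xz
        ... | inj₂ (there (here refl)) = trans (adj-sym G w x) xw

        blue-edges : ∀ i j → adj (ColouredGraph.blue H₄) i j ≡ true → adj G (f i) (f j) ≡ false
        blue-edges i j e with fromEdges-∈ ((0F , 1F) ∷ (2F , 3F) ∷ []) i j e
        ... | inj₁ (here refl)         = xy
        ... | inj₁ (there (here refl)) = zw
        ... | inj₂ (here refl)         = trans (adj-sym G y x) xy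
        ... | inj₂ (there (here refl)) = trans (adj-sym G w z) zw

    [_~_] [_≁_] [_≟_] : Fin n → Fin n → ℤ
    [ u ~ v ] = ⟦ does (u ~? v) ⟧
    [ u ≁ v ] = ⟦ does (u ≁? v) ⟧
    [ u ≟ v ] = ⟦ does (u Fin.≟ v) ⟧

    trichotomy : ∀ u v → 1ℤ ≡ [ u ~ v ] + [ u ≁ v ] + [ u ≟ v ]
    trichotomy u v with u Fin.≟ v | adj G u v in eq
    ... | yes refl | true  with () ← trans (sym eq) (adj-irr G u)
    ... | yes refl | false = refl
    ... | no _     | true  = refl
    ... | no _     | false = refl

    ~-sym : ∀ u v → [ u ~ v ] ≡ [ v ~ u ]
    ~-sym u v = cong (λ b → ⟦ does (b Bool.≟ true) ⟧) (adj-sym G u v)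

    degree codegree : Fin n → ℤ
    degree   u = ∑[ v < n ] [ u ~ v ]
    codegree u = ∑[ v < n ] [ u ≁ v ]

    common private-nbrs common-non : Fin n → Fin n → ℤ
    common       u v = ∑[ w < n ] ([ u ~ w ] * [ v ~ w ])
    private-nbrs u v = ∑[ w < n ] ([ u ~ w ] * [ v ≁ w ])
    common-non   u v = ∑[ w < n ] ([ u ≁ w ] * [ v ≁ w ])

    -- Once the edge xz is fixed, y and w are chosen independently of each other, so the two inner
    -- sums factor.
    embeddings-∑ : + embeddings H₄ G ≡
      ∑[ x < n ] ∑[ z < n ] ([ x ~ z ] * (codegree x * private-nbrs x z))
    embeddings-∑ = trans (count-maps₄ (λ f → isEmbedding? H₄ G (lookup f))) (∑-cong n λ x →
      -- The vertices are enumerated in the order x, y, z, w; exchanging y and z puts the edge xz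
      -- outermost.
      trans (∑-comm {m = n} {n = n} _) (∑-cong n λ z → begin
      ∑[ y < n ] ∑[ w < n ] ⟦ does (isEmbedding? H₄ G (lookup (x ∷ y ∷ z ∷ w ∷ []))) ⟧
        ≡⟨ ∑-cong n (λ y → ∑-cong n λ w → indicator x y z w) ⟩
      ∑[ y < n ] ∑[ w < n ] ([ x ~ z ] * [ x ≁ y ] * ([ x ~ w ] * [ z ≁ w ]))
        ≡⟨ ∑-cong n (λ y → sym (*-distribˡ-sum {n} ([ x ~ z ] * [ x ≁ y ]) _)) ⟩
      ∑[ y < n ] ([ x ~ z ] * [ x ≁ y ] * private-nbrs x z)
        ≡⟨ ∑-cong n (λ y → rearrange [ x ~ z ] [ x ≁ y ] (private-nbrs x z)) ⟩
      ∑[ y < n ] ([ x ~ z ] * private-nbrs x z * [ x ≁ y ])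
        ≡⟨ *-distribˡ-sum {n} ([ x ~ z ] * private-nbrs x z) _ ⟨
      [ x ~ z ] * private-nbrs x z * codegree x
        ≡⟨ rearrange′ [ x ~ z ] (private-nbrs x z) (codegree x) ⟩
      [ x ~ z ] * (codegree x * private-nbrs x z) ∎))
      where
      open ≡-Reasoning
      rearrange : ∀ a b c → a * b * c ≡ a * c * b
      rearrange = solve-∀
      rearrange′ : ∀ a b c → a * b * c ≡ a * (c * b)
      rearrange′ = solve-∀
      rearrange″ : ∀ a b c d → a * (b * (c * d)) ≡ a * c * (b * d)
      rearrange″ = solve-∀
      indicator : ∀ x y z w → ⟦ does (isEmbedding? H₄ G (lookup (x ∷ y ∷ z ∷ w ∷ []))) ⟧ ≡
        [ x ~ z ] * [ x ≁ y ] * ([ x ~ w ] * [ z ≁ w ])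
      indicator x y z w = begin
        ⟦ does (isEmbedding? H₄ G (lookup (x ∷ y ∷ z ∷ w ∷ []))) ⟧
          ≡⟨ cong ⟦_⟧ (does-⇔ (embedding⇔ x y z w) (isEmbedding? H₄ G (lookup (x ∷ y ∷ z ∷ w ∷ [])))
               ((x ~? z) ×-dec (x ~? w) ×-dec (x ≁? y) ×-dec (z ≁? w))) ⟩
        ⟦ does (x ~? z) ∧ (does (x ~? w) ∧ (does (x ≁? y) ∧ does (z ≁? w))) ⟧
          ≡⟨ trans (⟦∧⟧ (does (x ~? z)) _) (cong ([ x ~ z ] *_) (trans (⟦∧⟧ (does (x ~? w)) _) (cong ([ x ~ w ] *_) (⟦∧⟧ (does (x ≁? y)) _)))) ⟩
        [ x ~ z ] * ([ x ~ w ] * ([ x ≁ y ] * [ z ≁ w ]))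
          ≡⟨ rearrange″ [ x ~ z ] [ x ~ w ] [ x ≁ y ] [ z ≁ w ] ⟩
        [ x ~ z ] * [ x ≁ y ] * ([ x ~ w ] * [ z ≁ w ]) ∎

    ∑-pick : ∀ v (f : Fin n → ℤ) → ∑[ w < n ] (f w * [ v ≟ w ]) ≡ f v
    ∑-pick v f = begin
      ∑[ w < n ] (f w * [ v ≟ w ])  ≡⟨ ∑-cong n only-v ⟩
      ∑[ w < n ] (f v * [ v ≟ w ])  ≡⟨ *-distribˡ-sum {n} (f v) _ ⟨
      f v * ∑[ w < n ] [ v ≟ w ]    ≡⟨ cong (f v *_) (∑-diagonal v) ⟩
      f v * 1ℤ                      ≡⟨ *-identityʳ (f v) ⟩
      f v                           ∎
      where
      open ≡-Reasoning
      only-v : ∀ w → f w * [ v ≟ w ] ≡ f v * [ v ≟ w ]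
      only-v w with v Fin.≟ w
      ... | yes refl = refl
      ... | no  _    = trans (*-zeroʳ (f w)) (sym (*-zeroʳ (f v)))

    -- The neighbours of v, its non-neighbours and v itself partition the vertices. The splittings
    -- of degrees and codegrees below are instances.
    ∑-split : ∀ v (f : Fin n → ℤ) →
      sum f ≡ ∑[ w < n ] (f w * [ v ~ w ]) + ∑[ w < n ] (f w * [ v ≁ w ]) + f v
    ∑-split v f = begin
      ∑[ w < n ] f w
        ≡⟨ ∑-cong n (λ w → trans (sym (*-identityʳ (f w))) (trans (cong (f w *_) (trichotomy v w)) (distrib₃ (f w) _ _ _))) ⟩
      ∑[ w < n ] (f w * [ v ~ w ] + f w * [ v ≁ w ] + f w * [ v ≟ w ])
        ≡⟨ ∑-distrib-+ {n} _ _ ⟩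
      ∑[ w < n ] (f w * [ v ~ w ] + f w * [ v ≁ w ]) + ∑[ w < n ] (f w * [ v ≟ w ])
        ≡⟨ cong₂ _+_ (∑-distrib-+ {n} _ _) (∑-pick v f) ⟩
      ∑[ w < n ] (f w * [ v ~ w ]) + ∑[ w < n ] (f w * [ v ≁ w ]) + f v ∎
      where
      open ≡-Reasoning
      distrib₃ : ∀ a b c d → a * (b + c + d) ≡ a * b + a * c + a * d
      distrib₃ = solve-∀

    degree+codegree : ∀ v → + n ≡ degree v + codegree v + 1ℤ
    degree+codegree v = begin
      + n                   ≡⟨ *-identityʳ (+ n) ⟨
      + n * 1ℤ              ≡⟨ ∑-const n 1ℤ ⟨
      ∑[ w < n ] 1ℤ         ≡⟨ ∑-split v (λ _ → 1ℤ) ⟩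
      ∑[ w < n ] (1ℤ * [ v ~ w ]) + ∑[ w < n ] (1ℤ * [ v ≁ w ]) + 1ℤ
        ≡⟨ cong (_+ 1ℤ) (cong₂ _+_ (∑-cong n λ w → *-identityˡ [ v ~ w ]) (∑-cong n λ w → *-identityˡ [ v ≁ w ])) ⟩
      degree v + codegree v + 1ℤ ∎
      where open ≡-Reasoning

    degree-split : ∀ u v → degree u ≡ common u v + private-nbrs u v + [ u ~ v ]
    degree-split u v = ∑-split v [ u ~_]

    codegree-split : ∀ u v → codegree u ≡ private-nbrs v u + common-non u v + [ u ≁ v ]
    codegree-split u v = trans (∑-split v [ u ≁_])
      (cong (λ s → s + common-non u v + [ u ≁ v ]) (∑-cong n λ w → *-comm [ u ≁ w ] [ v ~ w ]))

    common-sym : ∀ u v → common u v ≡ common v u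
    common-sym u v = ∑-cong n λ w → *-comm [ u ~ w ] [ v ~ w ]

    -- On its edges, each triangle and each triple spanning exactly one edge is counted.
    defect : ℤ
    defect = ∑[ u < n ] ∑[ v < n ] ([ u ~ v ] * (common-non u v + common u v))

    ~⇒≁≡0 : ∀ u v → adj G u v ≡ true → [ u ≁ v ] ≡ 0ℤ
    ~⇒≁≡0 u v e with u Fin.≟ v | adj G u v
    ... | yes _ | _ = refl
    ... | no _ | true = refl

    codegree≡ : ∀ v → codegree v ≡ + n - 1ℤ - degree v
    codegree≡ v = trans (lemma (degree v) (codegree v)) (cong (λ m → m - 1ℤ - degree v) (sym (degree+codegree v)))
      where
      lemma : ∀ p e → e ≡ p + e + 1ℤ - 1ℤ - p
      lemma = solve-∀

    ~≥0 : ∀ u v → 0ℤ ≤ [ u ~ v ]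
    ~≥0 u v = ⟦⟧≥0 (does (u ~? v))

    ≁≥0 : ∀ u v → 0ℤ ≤ [ u ≁ v ]
    ≁≥0 u v = ⟦⟧≥0 (does (u ≁? v))

    codegree≥0 : ∀ v → 0ℤ ≤ codegree v
    codegree≥0 v = ∑-nonneg n (≁≥0 v)

    degree≤n : ∀ v → degree v ≤ + n
    degree≤n v = ≤-by (codegree≥0 v ⊕ num 1)
      (trans (lemma (degree v) (codegree v)) (cong (_- degree v) (sym (degree+codegree v))))
      where
      lemma : ∀ p e → e + 1ℤ ≡ p + e + 1ℤ - p
      lemma = solve-∀

    common≥0 : ∀ u v → 0ℤ ≤ common u v
    common≥0 u v = ∑-nonneg n λ w → ~≥0 u w ⊗ ~≥0 v w

    common-non≥0 : ∀ u v → 0ℤ ≤ common-non u v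
    common-non≥0 u v = ∑-nonneg n λ w → ≁≥0 u w ⊗ ≁≥0 v w

    private-nbrs≥0 : ∀ u v → 0ℤ ≤ private-nbrs u v
    private-nbrs≥0 u v = ∑-nonneg n λ w → ~≥0 u w ⊗ ≁≥0 v w

    common-non≤codegree : ∀ u v → common-non u v ≤ codegree u
    common-non≤codegree u v = ≤-by (private-nbrs≥0 v u ⊕ ≁≥0 u v)
      (trans (lemma (private-nbrs v u) (common-non u v) [ u ≁ v ]) (cong (_- common-non u v) (sym (codegree-split u v))))
      where
      lemma : ∀ a b c → a + c ≡ a + b + c - b
      lemma = solve-∀

    common-non-sym : ∀ u v → common-non u v ≡ common-non v u
    common-non-sym u v = ∑-cong n λ w → *-comm [ u ≁ w ] [ v ≁ w ]

    module _ {u v} (e : adj G u v ≡ true) where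

      private
        [e] : [ u ~ v ] ≡ 1ℤ
        [e] = cong (λ b → ⟦ does (b Bool.≟ true) ⟧) e

      private-nbrs-edge : private-nbrs u v ≡ degree u - 1ℤ - common u v
      private-nbrs-edge = trans (lemma (common u v) (private-nbrs u v))
        (cong (λ p → p - 1ℤ - common u v) (sym (trans (degree-split u v) (cong (_+_ (common u v + private-nbrs u v)) [e]))))
        where
        lemma : ∀ a b → b ≡ a + b + 1ℤ - 1ℤ - a
        lemma = solve-∀

    -- The non-neighbours of u other than common ones are the private neighbours of v. As u is
    -- itself a neighbour of v, their number is `degree v` - 1 - `common u v`.
    edge-common-non : ∀ {u v} → adj G u v ≡ true → common-non u v ≡ + n - degree u - degree v + common u v
    edge-common-non {u} {v} e = begin
      common-non u v                         ≡⟨ lemma (private-nbrs v u) (common-non u v) ⟩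
      private-nbrs v u + common-non u v + 0ℤ - private-nbrs v u
        ≡⟨ cong₂ _-_ (trans (cong (_+_ (private-nbrs v u + common-non u v)) (sym (~⇒≁≡0 u v e))) (sym (codegree-split u v)))
                     (private-nbrs-edge (trans (adj-sym G v u) e)) ⟩
      codegree u - (degree v - 1ℤ - common v u)
        ≡⟨ cong₂ (λ c t → c - (degree v - 1ℤ - t)) (codegree≡ u) (common-sym v u) ⟩
      + n - 1ℤ - degree u - (degree v - 1ℤ - common u v)
        ≡⟨ lemma′ (+ n) (degree u) (degree v) (common u v) ⟩
      + n - degree u - degree v + common u v   ∎
      where
      open ≡-Reasoning
      lemma : ∀ a b → b ≡ a + b + 0ℤ - a
      lemma = solve-∀
      lemma′ : ∀ n p q s → n - 1ℤ - p - (q - 1ℤ - s) ≡ n - p - q + s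
      lemma′ = solve-∀

    edge-mono : {f g : Fin n → Fin n → ℤ} → (∀ u v → adj G u v ≡ true → f u v ≤ g u v) →
      ∑[ u < n ] ∑[ v < n ] ([ u ~ v ] * f u v) ≤ ∑[ u < n ] ∑[ v < n ] ([ u ~ v ] * g u v)
    edge-mono {f} {g} f≤g = ∑-mono n λ u → ∑-mono n λ v → on-edges u v
      where
      on-edges : ∀ u v → [ u ~ v ] * f u v ≤ [ u ~ v ] * g u v
      on-edges u v with adj G u v in e
      ... | true  = subst₂ _≤_ (sym (*-identityˡ (f u v))) (sym (*-identityˡ (g u v))) (f≤g u v e)
      ... | false = ≤-refl

    edge-cong : {f g : Fin n → Fin n → ℤ} → (∀ u v → adj G u v ≡ true → f u v ≡ g u v) →
      ∑[ u < n ] ∑[ v < n ] ([ u ~ v ] * f u v) ≡ ∑[ u < n ] ∑[ v < n ] ([ u ~ v ] * g u v)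
    edge-cong f≡g = ≤-antisym (edge-mono λ u v e → ≤-reflexive (f≡g u v e))
                              (edge-mono λ u v e → ≤-reflexive (sym (f≡g u v e)))

    edge-+ : ∀ (f g : Fin n → Fin n → ℤ) →
      ∑[ u < n ] ∑[ v < n ] ([ u ~ v ] * (f u v + g u v)) ≡
      ∑[ u < n ] ∑[ v < n ] ([ u ~ v ] * f u v) + ∑[ u < n ] ∑[ v < n ] ([ u ~ v ] * g u v)
    edge-+ f g = trans (∑-cong n λ u → trans (∑-cong n λ v → *-distribˡ-+ [ u ~ v ] (f u v) (g u v)) (∑-distrib-+ {n} _ _))
                       (∑-distrib-+ {n} _ _)

    edge-scale : ∀ c (f : Fin n → Fin n → ℤ) →
      ∑[ u < n ] ∑[ v < n ] ([ u ~ v ] * (c * f u v)) ≡ c * ∑[ u < n ] ∑[ v < n ] ([ u ~ v ] * f u v)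
    edge-scale c f = trans
      (∑-cong n λ u → trans (∑-cong n λ v → lemma [ u ~ v ] c (f u v)) (sym (*-distribˡ-sum {n} c _)))
      (sym (*-distribˡ-sum {n} c _))
      where
      lemma : ∀ a c x → a * (c * x) ≡ c * (a * x)
      lemma = solve-∀

    edge-swap : ∀ (f : Fin n → Fin n → ℤ) →
      ∑[ u < n ] ∑[ v < n ] ([ u ~ v ] * f u v) ≡ ∑[ u < n ] ∑[ v < n ] ([ u ~ v ] * f v u)
    edge-swap f = trans (∑-comm {m = n} {n = n} _)
      (∑-cong n λ u → ∑-cong n λ v → cong (_* f v u) (~-sym v u))

    edge-endpoint : ∀ (h : Fin n → ℤ) →
      ∑[ u < n ] ∑[ v < n ] ([ u ~ v ] * h u) ≡ ∑[ u < n ] (degree u * h u)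
    edge-endpoint h = ∑-cong n λ u → sym (*-distribʳ-sum {n} (h u) _)

    -- The sum runs over ordered edges, so exchanging the ends does not change it; adding both
    -- versions makes the summand symmetric and produces the factor 2.
    embeddings-sym : + 2 * + embeddings H₄ G ≡
      ∑[ u < n ] ∑[ v < n ] ([ u ~ v ] * edge-count (+ n) (degree u) (degree v) (common u v))
    embeddings-sym = begin
      + 2 * + embeddings H₄ G
        ≡⟨ cong (+ 2 *_) (trans embeddings-∑ (edge-cong λ u v e → cong₂ _*_ (codegree≡ u) (private-nbrs-edge e))) ⟩
      + 2 * Λ                      ≡⟨ lemma Λ ⟩
      Λ + Λ                        ≡⟨ cong (_+_ Λ) (trans (edge-swap _) (edge-cong λ u v _ → cong (λ t → (+ n - 1ℤ - degree v) * (degree v - 1ℤ - t)) (common-sym v u))) ⟩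
      Λ + _                        ≡⟨ edge-+ _ _ ⟨
      ∑[ u < n ] ∑[ v < n ] ([ u ~ v ] * edge-count (+ n) (degree u) (degree v) (common u v)) ∎
      where
      open ≡-Reasoning
      Λ = ∑[ u < n ] ∑[ v < n ] ([ u ~ v ] * ((+ n - 1ℤ - degree u) * (degree u - 1ℤ - common u v)))
      lemma : ∀ x → + 2 * x ≡ x + x
      lemma = solve-∀

    -- Upper bound for the number of embeddings, with stability

    module _ {ν μ} (T : Typical (+ n) ν μ) where
      open Typical T

      private
        half-weight : Fin n → ℤ
        half-weight u = μ * (+ n * (+ n - degree u) + gap (+ n) ν (degree u))

      -- The weight is a sum of one term per end, so the edge sum becomes a sum over vertices in
      -- which degree p occurs p times. The vertex bound holds because the difference is μ (n - p)
      -- (ν - p (n - p)).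
      total-edge-weight : ∑[ u < n ] ∑[ v < n ] ([ u ~ v ] * edge-weight (+ n) ν μ (degree u) (degree v))
        ≤ + 2 * (+ n * (μ * (+ n * ν)))
      total-edge-weight = begin
        ∑[ u < n ] ∑[ v < n ] ([ u ~ v ] * edge-weight (+ n) ν μ (degree u) (degree v))
          ≡⟨ trans (edge-cong λ u v _ → lemma₁ (+ n) μ (degree u) (degree v) (gap (+ n) ν (degree u)) (gap (+ n) ν (degree v))) (edge-+ _ _) ⟩
        ∑[ u < n ] ∑[ v < n ] ([ u ~ v ] * half-weight u) + ∑[ u < n ] ∑[ v < n ] ([ u ~ v ] * half-weight v)
          ≡⟨ cong₂ _+_ (edge-endpoint half-weight) (trans (edge-swap _) (edge-endpoint half-weight)) ⟩
        W + W
          ≡⟨ lemma₂ W ⟨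
        + 2 * W
          ≤⟨ *-monoˡ-≤-nonNeg (+ 2) (∑-mono n vertex) ⟩
        + 2 * ∑[ u < n ] (μ * (+ n * ν))
          ≡⟨ cong (+ 2 *_) (∑-const n _) ⟩
        + 2 * (+ n * (μ * (+ n * ν))) ∎
        where
        open ≤-Reasoning
        W = ∑[ u < n ] (degree u * half-weight u)
        lemma₁ : ∀ n μ p q g h → μ * (n * (+ 2 * n - p - q) + g + h) ≡ μ * (n * (n - p) + g) + μ * (n * (n - q) + h)
        lemma₁ = solve-∀
        lemma₂ : ∀ x → + 2 * x ≡ x + x
        lemma₂ = solve-∀
        lemma₃ : ∀ n μ ν p → μ * ((n - p) * (ν - p * (n - p))) ≡ μ * (n * ν) - p * (μ * (n * (n - p) + (ν - p * (n - p))))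
        lemma₃ = solve-∀
        vertex : ∀ u → degree u * half-weight u ≤ μ * (+ n * ν)
        vertex u = ≤-by (μ≥0 ⊗ (i≤j⇒0≤j-i (degree≤n u) ⊗ i≤j⇒0≤j-i (ν-max (degree u)))) (lemma₃ (+ n) μ ν (degree u))

      -- Summing `edge-inequality` over all ordered edges gives n² times the claim. Its right side
      -- is 128 times 2 μ ν, the number of embeddings into the balanced complete bipartite graph.
      embeddings-stability : + 128 * + embeddings H₄ G + + n * defect ≤ + 256 * (μ * ν)
      embeddings-stability = *-cancelˡ-≤-pos _ _ (+ n * + n) {{n²-positive}} (begin
        + n * + n * (+ 128 * + embeddings H₄ G + + n * defect)
          ≡⟨ lemma₁ (+ n) (+ embeddings H₄ G) defect ⟩
        + 64 * (+ n * + n) * (+ 2 * + embeddings H₄ G) + + n * + n * + n * defect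
          ≡⟨ cong₂ _+_ (trans (cong (+ 64 * (+ n * + n) *_) embeddings-sym) (sym (edge-scale (+ 64 * (+ n * + n)) _))) (sym (edge-scale (+ n * + n * + n) _)) ⟩
        _ ≡⟨ edge-+ (λ u v → + 64 * (+ n * + n) * edge-count (+ n) (degree u) (degree v) (common u v)) (λ u v → + n * + n * + n * (common-non u v + common u v)) ⟨
        ∑[ u < n ] ∑[ v < n ] ([ u ~ v ] * (+ 64 * (+ n * + n) * edge-count (+ n) (degree u) (degree v) (common u v) + + n * + n * + n * (common-non u v + common u v)))
          ≤⟨ edge-mono edge ⟩
        ∑[ u < n ] ∑[ v < n ] ([ u ~ v ] * (+ 128 * edge-weight (+ n) ν μ (degree u) (degree v)))
          ≡⟨ edge-scale (+ 128) _ ⟩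
        + 128 * ∑[ u < n ] ∑[ v < n ] ([ u ~ v ] * edge-weight (+ n) ν μ (degree u) (degree v))
          ≤⟨ *-monoˡ-≤-nonNeg (+ 128) total-edge-weight ⟩
        + 128 * (+ 2 * (+ n * (μ * (+ n * ν))))
          ≡⟨ lemma₂ (+ n) μ ν ⟩
        + n * + n * (+ 256 * (μ * ν)) ∎)
        where
        open ≤-Reasoning
        n²-positive : Positive (+ n * + n)
        n²-positive = positive (suc[i]≤j⇒i<j (≤-by (m ⊗ (m ⊕ num 40) ⊕ num 399) (lemma₃ (+ n))))
          where
          m = i≤j⇒0≤j-i large
          lemma₃ : ∀ n → (n - + 20) * (n - + 20 + + 40) + + 399 ≡ n * n - 1ℤ
          lemma₃ = solve-∀
        lemma₁ : ∀ n e d → n * n * (+ 128 * e + n * d) ≡ + 64 * (n * n) * (+ 2 * e) + n * n * n * d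
        lemma₁ = solve-∀
        lemma₂ : ∀ n μ ν → + 128 * (+ 2 * (n * (μ * (n * ν)))) ≡ n * n * (+ 256 * (μ * ν))
        lemma₂ = solve-∀
        edge : ∀ u v → adj G u v ≡ true →
          + 64 * (+ n * + n) * edge-count (+ n) (degree u) (degree v) (common u v) + + n * + n * + n * (common-non u v + common u v)
            ≤ + 128 * edge-weight (+ n) ν μ (degree u) (degree v)
        edge u v e = subst (λ x → x + + n * + n * + n * (common-non u v + common u v) ≤ + 128 * edge-weight (+ n) ν μ (degree u) (degree v))
          (sym (*-assoc (+ 64) (+ n * + n) _))
          (edge-inequality T (degree u) (degree v) (common-non u v) (common u v)
            (common-non≥0 u v) (common≥0 u v) (edge-common-non e)
            (subst (common-non u v ≤_) (codegree≡ u) (common-non≤codegree u v))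
            (subst₂ _≤_ (common-non-sym v u) (codegree≡ v) (common-non≤codegree v u)))

    -- The complete bipartite graph to compare with has parts N(x) and its complement.
    neighbour-part : Fin n → Fin n → Fin 2
    neighbour-part x u = side (adj G x u)

    ≁-sym : ∀ u v → [ u ≁ v ] ≡ [ v ≁ u ]
    ≁-sym u v = cong ⟦_⟧ (does-⇔ (mk⇔ flip flip) (u ≁? v) (v ≁? u))
      where
      flip : ∀ {u v} → u ≁ v → v ≁ u
      flip (u≢v , e) = u≢v ∘ sym , trans (adj-sym G _ _) e

    -- Odd triples and the distance to complete bipartite graphs

    module _ (x u v : Fin n) where

      -- The four summands stand for a triangle, only uv, only xu and only xv. Products of
      -- indicators allow each of them to be summed over the vertex opposite to an edge.
      odd-triple : ℤ
      odd-triple =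
        [ u ~ v ] * ([ x ~ u ] * [ x ~ v ]) + [ u ~ v ] * ([ x ≁ u ] * [ x ≁ v ])
          + [ x ~ u ] * ([ x ≁ v ] * [ u ≁ v ]) + [ x ~ v ] * ([ x ≁ u ] * [ u ≁ v ])

      private
        t₁ = ~≥0 u v ⊗ (~≥0 x u ⊗ ~≥0 x v)
        t₂ = ~≥0 u v ⊗ (≁≥0 x u ⊗ ≁≥0 x v)
        t₃ = ~≥0 x u ⊗ (≁≥0 x v ⊗ ≁≥0 u v)
        t₄ = ~≥0 x v ⊗ (≁≥0 x u ⊗ ≁≥0 u v)

        all-one : ∀ {a b c} → a ≡ 1ℤ → b ≡ 1ℤ → c ≡ 1ℤ → 1ℤ ≤ a * (b * c)
        all-one refl refl refl = ≤-refl

        adjacent : ∀ {y z} → adj G y z ≡ true → [ y ~ z ] ≡ 1ℤ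
        adjacent e = cong (λ b → ⟦ does (b Bool.≟ true) ⟧) e

        non-adjacent : ∀ {y z} → y ≢ z → adj G y z ≡ false → [ y ≁ z ] ≡ 1ℤ
        non-adjacent {y} {z} y≢z e = cong ⟦_⟧ (dec-true (y ≁? z) (y≢z , e))

        clash : ∀ {b : Bool} {A : Set} → b ≡ true → b ≡ false → A
        clash refl ()

      -- The parts of u and v are given by b and c, so uv is misplaced exactly when an odd number of
      -- a, b, c are `true`. If two of x, u, v coincide, one of these values is `false` and the
      -- other two agree, so the number is even; hence the odd cases provide the distinctness that
      -- `≁` asks for.
      misplaced≤odd : ∀ a b c → adj G u v ≡ a → adj G x u ≡ b → adj G x v ≡ c →
        ⟦ not (does (a Bool.≟ adj K₂ (side b) (side c))) ⟧ ≤ odd-triple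
      misplaced≤odd true  true  false _ _ _ = t₁ ⊕ t₂ ⊕ t₃ ⊕ t₄
      misplaced≤odd true  false true  _ _ _ = t₁ ⊕ t₂ ⊕ t₃ ⊕ t₄
      misplaced≤odd false true  true  _ _ _ = t₁ ⊕ t₂ ⊕ t₃ ⊕ t₄
      misplaced≤odd false false false _ _ _ = t₁ ⊕ t₂ ⊕ t₃ ⊕ t₄
      misplaced≤odd true  true  true  uv xu xv =
        +-mono-≤ (+-mono-≤ (+-mono-≤ (all-one (adjacent uv) (adjacent xu) (adjacent xv)) t₂) t₃) t₄
      misplaced≤odd true  false false uv xu xv =
        +-mono-≤ (+-mono-≤ (+-mono-≤ t₁ (all-one (adjacent uv) (non-adjacent x≢u xu) (non-adjacent x≢v xv))) t₃) t₄
        where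
        x≢u : x ≢ u
        x≢u refl = clash uv xv
        x≢v : x ≢ v
        x≢v refl = clash (trans (adj-sym G v u) uv) xu
      misplaced≤odd false true  false uv xu xv =
        +-mono-≤ (+-mono-≤ (t₁ ⊕ t₂) (all-one (adjacent xu) (non-adjacent x≢v xv) (non-adjacent u≢v uv))) t₄
        where
        x≢v : x ≢ v
        x≢v refl = clash (trans (adj-sym G u v) xu) uv
        u≢v : u ≢ v
        u≢v refl = clash xu xv
      misplaced≤odd false false true  uv xu xv =
        +-mono-≤ (t₁ ⊕ t₂ ⊕ t₃) (all-one (adjacent xv) (non-adjacent x≢u xu) (non-adjacent u≢v uv))
        where
        x≢u : x ≢ u
        x≢u refl = clash xv uv
        u≢v : u ≢ v
        u≢v refl = clash xv xu

    -- The labelling is kept, as an upper bound for the edit distance is enough; `relabel Perm.id`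
    -- puts it in the form of `editDistance-≤`.
    misplaced : Fin n → ℤ
    misplaced x = + differences (relabel Perm.id G) (blowup K₂ (neighbour-part x))

    misplaced≤ : ∀ x → misplaced x ≤ ∑[ u < n ] ∑[ v < n ] odd-triple x u v
    misplaced≤ x = begin
      misplaced x
        ≡⟨ trans (length-filter _ (cartesianProduct (allFin n) (allFin n))) (listSum-pairs n _) ⟩
      ∑[ u < n ] ∑[ v < n ] ⟦ does (u Fin.<? v) ∧ not (does (adj G u v Bool.≟ adj (blowup K₂ (neighbour-part x)) u v)) ⟧
        -- The restriction to u < v is dropped, so each pair is counted in both orders; this affects
        -- only the constant.
        ≤⟨ (∑-mono n λ u → ∑-mono n λ v → ≤-trans (weaken (does (u Fin.<? v)) _) (misplaced≤odd x u v _ _ _ refl refl refl)) ⟩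
      ∑[ u < n ] ∑[ v < n ] odd-triple x u v ∎
      where
      open ≤-Reasoning
      weaken : ∀ b c → ⟦ b ∧ c ⟧ ≤ ⟦ c ⟧
      weaken true  c = ≤-refl
      weaken false c = ⟦⟧≥0 c

    ∑-rotate : ∀ (f : Fin n → Fin n → Fin n → ℤ) →
      ∑[ x < n ] ∑[ u < n ] ∑[ v < n ] f x u v ≡ ∑[ u < n ] ∑[ v < n ] ∑[ x < n ] f x u v
    ∑-rotate f = trans (∑-comm {m = n} {n = n} _) (∑-cong n λ u → ∑-comm {m = n} {n = n} _)

    ∑³-+ : ∀ (f g : Fin n → Fin n → Fin n → ℤ) →
      ∑[ x < n ] ∑[ u < n ] ∑[ v < n ] (f x u v + g x u v) ≡
      ∑[ x < n ] ∑[ u < n ] ∑[ v < n ] f x u v + ∑[ x < n ] ∑[ u < n ] ∑[ v < n ] g x u v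
    ∑³-+ f g = trans (∑-cong n λ x → trans (∑-cong n λ u → ∑-distrib-+ {n} _ _) (∑-distrib-+ {n} _ _)) (∑-distrib-+ {n} _ _)

    edge-factor : ∀ (f : Fin n → Fin n → Fin n → ℤ) →
      ∑[ u < n ] ∑[ v < n ] ∑[ w < n ] ([ u ~ v ] * f u v w) ≡ ∑[ u < n ] ∑[ v < n ] ([ u ~ v ] * ∑[ w < n ] f u v w)
    edge-factor f = ∑-cong n λ u → ∑-cong n λ v → sym (*-distribˡ-sum {n} [ u ~ v ] _)

    -- Summed over the vertex off the edge, triangles give S, and each of the three positions of a
    -- single edge gives R after renaming. The total S + 3 R is compared with `defect` = R + S.
    odd-triples≤ : ∑[ x < n ] ∑[ u < n ] ∑[ v < n ] odd-triple x u v ≤ + 3 * defect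
    odd-triples≤ = begin
      ∑[ x < n ] ∑[ u < n ] ∑[ v < n ] odd-triple x u v
        ≡⟨ trans (∑³-+ _ _) (cong₂ _+_ (trans (∑³-+ _ _) (cong₂ _+_ (∑³-+ _ _) refl)) refl) ⟩
      ∑[ x < n ] ∑[ u < n ] ∑[ v < n ] ([ u ~ v ] * ([ x ~ u ] * [ x ~ v ]))
        + ∑[ x < n ] ∑[ u < n ] ∑[ v < n ] ([ u ~ v ] * ([ x ≁ u ] * [ x ≁ v ]))
        + ∑[ x < n ] ∑[ u < n ] ∑[ v < n ] ([ x ~ u ] * ([ x ≁ v ] * [ u ≁ v ]))
        + ∑[ x < n ] ∑[ u < n ] ∑[ v < n ] ([ x ~ v ] * ([ x ≁ u ] * [ u ≁ v ]))
        ≡⟨ cong₂ _+_ (cong₂ _+_ (cong₂ _+_ triangles apex) (edge-factor _)) far ⟩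
      S + R + R + R
        ≤⟨ ≤-by (num 2 ⊗ S≥0) (lemma S R) ⟩
      + 3 * (R + S)
        ≡⟨ cong (+ 3 *_) (edge-+ _ _) ⟨
      + 3 * defect ∎
      where
      open ≤-Reasoning
      S = ∑[ u < n ] ∑[ v < n ] ([ u ~ v ] * common u v)
      R = ∑[ u < n ] ∑[ v < n ] ([ u ~ v ] * common-non u v)
      S≥0 : 0ℤ ≤ S
      S≥0 = ∑-nonneg n λ u → ∑-nonneg n λ v → ~≥0 u v ⊗ common≥0 u v
      lemma : ∀ s r → + 2 * s ≡ + 3 * (r + s) - (s + r + r + r)
      lemma = solve-∀
      triangles = trans (∑-rotate _) (trans (edge-factor _)
        (∑-cong n λ u → ∑-cong n λ v → cong ([ u ~ v ] *_) (∑-cong n λ x → cong₂ _*_ (~-sym x u) (~-sym x v))))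
      apex = trans (∑-rotate _) (trans (edge-factor _)
        (∑-cong n λ u → ∑-cong n λ v → cong ([ u ~ v ] *_) (∑-cong n λ x → cong₂ _*_ (≁-sym x u) (≁-sym x v))))
      far = trans (∑-cong n λ x → ∑-comm {m = n} {n = n} _) (trans (edge-factor _)
        (∑-cong n λ x → ∑-cong n λ v → cong ([ x ~ v ] *_) (∑-cong n λ u → cong ([ x ≁ u ] *_) (≁-sym u v))))

    -- The vertex x with the fewest misplaced pairs is at most the average, and the sum over all x
    -- counts odd triples.
    editDistance-bound : .{{_ : ℕ.NonZero n}} →
      ∃[ x ] + n * + editDistance G (blowup K₂ (neighbour-part x)) ≤ + 3 * defect
    editDistance-bound with x , avg ← below-average misplaced = x , (begin
      + n * + editDistance G (blowup K₂ (neighbour-part x))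
        ≤⟨ *-monoˡ-≤-nonNeg (+ n) (+≤+ (editDistance-≤ G (blowup K₂ (neighbour-part x)) Perm.id)) ⟩
      + n * misplaced x
        ≤⟨ avg ⟩
      ∑[ x < n ] misplaced x
        ≤⟨ ∑-mono n misplaced≤ ⟩
      ∑[ x < n ] ∑[ u < n ] ∑[ v < n ] odd-triple x u v
        ≤⟨ odd-triples≤ ⟩
      + 3 * defect ∎)
      where open ≤-Reasoning

  -- The complete bipartite graph

  ∑-initial : ∀ a b → ∑[ u < a ℕ.+ b ] ⟦ toℕ u ℕ.<ᵇ a ⟧ ≡ + a
  ∑-initial zero    b = ∑-zero b
  ∑-initial (suc a) b = cong (_+_ 1ℤ) (∑-initial a b)

  ⟦not⟧ : ∀ b → ⟦ not b ⟧ + ⟦ b ⟧ ≡ 1ℤ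
  ⟦not⟧ true  = refl
  ⟦not⟧ false = refl

  module _ (a b : ℕ) where
    private
      n = a ℕ.+ b

      left : Fin n → Bool
      left u = toℕ u ℕ.<ᵇ a

    completeBipartite : Graph n
    completeBipartite = blowup K₂ (side ∘ left)

    private
      G = completeBipartite
      infix 4 _∼_
      _∼_ : Fin n → Fin n → ℤ
      _∼_ = [_~_] G

      cross-size : Bool → ℤ
      cross-size c = if c then + b else + a

      ∑-right : ∑[ u < n ] ⟦ not (left u) ⟧ ≡ + b
      ∑-right = begin
        R                        ≡⟨ lemma R (+ a) ⟩
        R + + a - + a            ≡⟨ cong (λ s → R + s - + a) (∑-initial a b) ⟨
        R + L - + a              ≡⟨ cong (_- + a) (trans (sym (∑-distrib-+ {n} _ _)) (∑-cong n (⟦not⟧ ∘ left))) ⟩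
        ∑[ u < n ] 1ℤ - + a      ≡⟨ cong (_- + a) (trans (∑-const n 1ℤ) (trans (*-identityʳ (+ n)) (pos-+ a b))) ⟩
        + a + + b - + a          ≡⟨ lemma′ (+ a) (+ b) ⟩
        + b                      ∎
        where
        open ≡-Reasoning
        R = ∑[ u < n ] ⟦ not (left u) ⟧
        L = ∑[ u < n ] ⟦ left u ⟧
        lemma : ∀ x y → x ≡ x + y - y
        lemma = solve-∀
        lemma′ : ∀ x y → x + y - x ≡ y
        lemma′ = solve-∀

    completeBipartite-degree : ∀ u → degree G u ≡ cross-size (left u)
    completeBipartite-degree u with left u
    ... | true  = trans (∑-cong n λ v → cross (left v)) ∑-right
      where
      cross : ∀ c → ⟦ does (adj K₂ 1F (side c) Bool.≟ true) ⟧ ≡ ⟦ not c ⟧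
      cross true  = refl
      cross false = refl
    ... | false = trans (∑-cong n λ v → cross (left v)) (∑-initial a b)
      where
      cross : ∀ c → ⟦ does (adj K₂ 0F (side c) Bool.≟ true) ⟧ ≡ ⟦ c ⟧
      cross true  = refl
      cross false = refl

    completeBipartite-common : ∀ u v → adj G u v ≡ true → common G u v ≡ 0ℤ
    completeBipartite-common u v e = trans (∑-cong n λ w → triangle-free (left u) (left v) (left w) e) (∑-zero n)
      where
      triangle-free : ∀ c d f → adj K₂ (side c) (side d) ≡ true →
        ⟦ does (adj K₂ (side c) (side f) Bool.≟ true) ⟧ * ⟦ does (adj K₂ (side d) (side f) Bool.≟ true) ⟧ ≡ 0ℤ
      triangle-free true  false true  _ = refl
      triangle-free true  false false _ = refl
      triangle-free false true  true  _ = refl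
      triangle-free false true  false _ = refl

    -- Each of the 2 a b ordered edges carries the same number of embeddings: the non-neighbours of
    -- an end are the rest of its own part, and its private neighbours are the opposite part without
    -- the other end.
    completeBipartite-embeddings :
      + embeddings H₄ G ≡ + 2 * ((+ a * + b) * ((+ a - 1ℤ) * (+ b - 1ℤ)))
    completeBipartite-embeddings = begin
      + embeddings H₄ G
        ≡⟨ trans (embeddings-∑ G) (edge-cong G λ u v e → edge u v e) ⟩
      ∑[ u < n ] ∑[ v < n ] ((u ∼ v) * μ)
        ≡⟨ edge-endpoint G (λ _ → μ) ⟩
      ∑[ u < n ] (degree G u * μ)
        ≡⟨ *-distribʳ-sum {n} μ _ ⟨
      ∑[ u < n ] degree G u * μ
        ≡⟨ cong (_* μ) (∑-cong n (λ u → trans (completeBipartite-degree u) (cross (left u)))) ⟩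
      ∑[ u < n ] (+ b * ⟦ left u ⟧ + + a * ⟦ not (left u) ⟧) * μ
        ≡⟨ cong (_* μ) (trans (∑-distrib-+ {n} _ _) (cong₂ _+_ (sym (*-distribˡ-sum {n} (+ b) _)) (sym (*-distribˡ-sum {n} (+ a) _)))) ⟩
      (+ b * (∑[ u < n ] ⟦ left u ⟧) + + a * (∑[ u < n ] ⟦ not (left u) ⟧)) * μ
        ≡⟨ cong₂ (λ s t → (+ b * s + + a * t) * μ) (∑-initial a b) ∑-right ⟩
      (+ b * + a + + a * + b) * μ
        ≡⟨ lemma (+ a) (+ b) μ ⟩
      + 2 * ((+ a * + b) * μ) ∎
      where
      open ≡-Reasoning
      μ = (+ a - 1ℤ) * (+ b - 1ℤ)
      lemma : ∀ a b μ → (b * a + a * b) * μ ≡ + 2 * ((a * b) * μ)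
      lemma = solve-∀
      cross : ∀ c → cross-size c ≡ + b * ⟦ c ⟧ + + a * ⟦ not c ⟧
      cross true  = lemma′ (+ a) (+ b)
        where
        lemma′ : ∀ a b → b ≡ b * 1ℤ + a * 0ℤ
        lemma′ = solve-∀
      cross false = lemma′ (+ a) (+ b)
        where
        lemma′ : ∀ a b → a ≡ b * 0ℤ + a * 1ℤ
        lemma′ = solve-∀
      edge-value : ∀ c d → adj K₂ (side c) (side d) ≡ true →
        (+ a + + b - 1ℤ - cross-size c) * (cross-size c - 1ℤ - 0ℤ) ≡ μ
      edge-value true  false _ = lemma′ (+ a) (+ b)
        where
        lemma′ : ∀ a b → (a + b - 1ℤ - b) * (b - 1ℤ - 0ℤ) ≡ (a - 1ℤ) * (b - 1ℤ)
        lemma′ = solve-∀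
      edge-value false true  _ = lemma′ (+ a) (+ b)
        where
        lemma′ : ∀ a b → (a + b - 1ℤ - a) * (a - 1ℤ - 0ℤ) ≡ (a - 1ℤ) * (b - 1ℤ)
        lemma′ = solve-∀
      edge : ∀ u v → adj G u v ≡ true → codegree G u * private-nbrs G u v ≡ μ
      edge u v e = trans
        (cong₂ _*_ (trans (codegree≡ G u) (cong₂ (λ m p → m - 1ℤ - p) (pos-+ a b) (completeBipartite-degree u)))
                   (trans (private-nbrs-edge G e) (cong₂ (λ p s → p - 1ℤ - s) (completeBipartite-degree u) (completeBipartite-common u v e))))
        (edge-value (left u) (left v) e)

-- From integer counts to rational densities

module Densities where

  open Counting
  open import Data.Integer.Base using (ℤ; 0ℤ; 1ℤ)
  open import Data.Rational.Base hiding (_/_; ½)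
  open import Data.Rational.Properties
  open import Data.Rational.Unnormalised.Base using (mkℚᵘ; *≡*; *≤*; *<*)
  open +-*-Solver

  ι : ℤ.ℤ → ℚ
  ι i = i / 1

  toℚᵘ-/ : ∀ i d → toℚᵘ (i / suc d) ℚᵘ.≃ mkℚᵘ i d
  toℚᵘ-/ i d = toℚᵘ-fromℚᵘ (mkℚᵘ i d)

  ι-* : ∀ i j → ι (i ℤ.* j) ≡ ι i * ι j
  ι-* i j = toℚᵘ-injective (begin
    toℚᵘ (ι (i ℤ.* j))            ≈⟨ toℚᵘ-/ (i ℤ.* j) 0 ⟩
    mkℚᵘ i 0 ℚᵘ.* mkℚᵘ j 0        ≈⟨ ℚᵘ.*-cong (toℚᵘ-/ i 0) (toℚᵘ-/ j 0) ⟨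
    toℚᵘ (ι i) ℚᵘ.* toℚᵘ (ι j)    ≈⟨ toℚᵘ-homo-* (ι i) (ι j) ⟨
    toℚᵘ (ι i * ι j)              ∎)
    where open ℚᵘ.≃-Reasoning

  ι-+ : ∀ i j → ι (i ℤ.+ j) ≡ ι i + ι j
  ι-+ i j = toℚᵘ-injective (begin
    toℚᵘ (ι (i ℤ.+ j))            ≈⟨ toℚᵘ-/ (i ℤ.+ j) 0 ⟩
    mkℚᵘ (i ℤ.+ j) 0              ≈⟨ *≡* (cong (ℤ._* ℤ.1ℤ) (cong₂ ℤ._+_ (sym (ℤ.*-identityʳ i)) (sym (ℤ.*-identityʳ j)))) ⟩
    mkℚᵘ i 0 ℚᵘ.+ mkℚᵘ j 0        ≈⟨ ℚᵘ.+-cong (toℚᵘ-/ i 0) (toℚᵘ-/ j 0) ⟨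
    toℚᵘ (ι i) ℚᵘ.+ toℚᵘ (ι j)    ≈⟨ toℚᵘ-homo-+ (ι i) (ι j) ⟨
    toℚᵘ (ι i + ι j)              ∎)
    where open ℚᵘ.≃-Reasoning

  ι-neg : ∀ i → ι (ℤ.- i) ≡ - ι i
  ι-neg i = toℚᵘ-injective (begin
    toℚᵘ (ι (ℤ.- i))     ≈⟨ toℚᵘ-/ (ℤ.- i) 0 ⟩
    ℚᵘ.- mkℚᵘ i 0        ≈⟨ ℚᵘ.-‿cong (toℚᵘ-/ i 0) ⟨
    ℚᵘ.- toℚᵘ (ι i)      ≈⟨ toℚᵘ-homo‿- (ι i) ⟨
    toℚᵘ (- ι i)         ∎)
    where open ℚᵘ.≃-Reasoning

  ι-- : ∀ i j → ι (i ℤ.- j) ≡ ι i - ι j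
  ι-- i j = trans (ι-+ i (ℤ.- j)) (cong (λ q → ι i + q) (ι-neg j))

  ι-mono-≤ : ∀ {i j} → i ℤ.≤ j → ι i ≤ ι j
  ι-mono-≤ {i} {j} i≤j = toℚᵘ-cancel-≤ (begin
    toℚᵘ (ι i)    ≃⟨ toℚᵘ-/ i 0 ⟩
    mkℚᵘ i 0      ≤⟨ *≤* (ℤ.*-monoʳ-≤-nonNeg ℤ.1ℤ i≤j) ⟩
    mkℚᵘ j 0      ≃⟨ toℚᵘ-/ j 0 ⟨
    toℚᵘ (ι j)    ∎)
    where open ℚᵘ.≤-Reasoning

  ι-mono-< : ∀ {i j} → i ℤ.< j → ι i < ι j
  ι-mono-< {i} {j} i<j = toℚᵘ-cancel-< (begin-strict
    toℚᵘ (ι i)    ≃⟨ toℚᵘ-/ i 0 ⟩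
    mkℚᵘ i 0      <⟨ *<* (ℤ.*-monoʳ-<-pos ℤ.1ℤ i<j) ⟩
    mkℚᵘ j 0      ≃⟨ toℚᵘ-/ j 0 ⟨
    toℚᵘ (ι j)    ∎)
    where open ℚᵘ.≤-Reasoning

  ι-positive : ∀ d .{{_ : ℕ.NonZero d}} → Positive (ι (ℤ.+ d))
  ι-positive (suc d) = positive {ι (ℤ.+ suc d)} (ι-mono-< {ℤ.0ℤ} {ℤ.+ suc d} (ℤ.+<+ (ℕ.s≤s ℕ.z≤n)))

  /-*-ι : ∀ i d .{{_ : ℕ.NonZero d}} → i / d * ι (ℤ.+ d) ≡ ι i
  /-*-ι i (suc d) = toℚᵘ-injective (begin
    toℚᵘ (i / suc d * ι (ℤ.+ suc d))          ≈⟨ toℚᵘ-homo-* (i / suc d) (ι (ℤ.+ suc d)) ⟩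
    toℚᵘ (i / suc d) ℚᵘ.* toℚᵘ (ι (ℤ.+ suc d)) ≈⟨ ℚᵘ.*-cong (toℚᵘ-/ i d) (toℚᵘ-/ (ℤ.+ suc d) 0) ⟩
    mkℚᵘ i d ℚᵘ.* mkℚᵘ (ℤ.+ suc d) 0          ≈⟨ *≡* (trans (ℤ.*-identityʳ (i ℤ.* ℤ.+ suc d)) (cong (λ m → i ℤ.* ℤ.+ suc m) (sym (ℕ.*-identityʳ d)))) ⟩
    mkℚᵘ i 0                                  ≈⟨ toℚᵘ-/ i 0 ⟨
    toℚᵘ (ι i)                                ∎)
    where
    open ℚᵘ.≃-Reasoning

  /-mono-≤ : ∀ i j d .{{_ : ℕ.NonZero d}} → i ℤ.≤ j → i / d ≤ j / d
  /-mono-≤ i j d i≤j = *-cancelʳ-≤-pos (ι (+ d)) {{ι-positive d}} (begin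
    i / d * ι (+ d)   ≡⟨ /-*-ι i d ⟩
    ι i               ≤⟨ ι-mono-≤ i≤j ⟩
    ι j               ≡⟨ /-*-ι j d ⟨
    j / d * ι (+ d)   ∎)
    where open ≤-Reasoning

  balanced-halves : ∀ n → Balanced (+ ℕ.⌊ n /2⌋) (+ ℕ.⌈ n /2⌉)
  balanced-halves 0 = inj₁ refl
  balanced-halves 1 = inj₂ refl
  balanced-halves (suc (suc n)) with balanced-halves n
  ... | inj₁ eq = inj₁ (cong (λ x → 1ℤ ℤ.+ x) eq)
  ... | inj₂ eq = inj₂ (cong (λ x → 1ℤ ℤ.+ x) eq)

  density-≤ : ∀ {κ n} (H : ColouredGraph κ) (G : Graph n) (κ≤n : κ ℕ.≤ n) {i} → + embeddings H G ℤ.≤ i →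
    density H G κ≤n ≤ (i / (n P′ κ)) {{P′-nonZero κ≤n}}
  density-≤ {κ} {n} H G κ≤n {i} e≤i = /-mono-≤ (+ embeddings H G) i (n P′ κ) {{P′-nonZero κ≤n}} e≤i

  maxDensity-≤ : ∀ {κ} (H : ColouredGraph κ) n (κ≤n : κ ℕ.≤ n) {i} → (∀ (G : Graph n) → + embeddings H G ℤ.≤ i) →
    maxDensity H n κ≤n ≤ (i / (n P′ κ)) {{P′-nonZero κ≤n}}
  maxDensity-≤ H n κ≤n bound = density-≤ H G κ≤n (bound G)
    where
    open Extrema (DecTotalOrder.totalOrder ≤-decTotalOrder) using (argmax)
    G = argmax (λ G → density H G κ≤n) (emptyGraph n) (allGraphs n)

  ≤-maxDensity : ∀ {κ n} (H : ColouredGraph κ) (G : Graph n) (κ≤n : κ ℕ.≤ n) {i} → + embeddings H G ≡ i →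
    (i / (n P′ κ)) {{P′-nonZero κ≤n}} ≤ maxDensity H n κ≤n
  ≤-maxDensity {κ} {n} H G κ≤n {i} refl = density≤maxDensity H G κ≤n

  -- With P at most n⁴, two of the four factors n are spent on the two hypotheses and the other two
  -- remain as n². The constant is 384 = 3 · 128.
  rescale : ∀ n e P d k → + n ℤ.* + e ℤ.≤ + 3 ℤ.* d → + n ℤ.* d ℤ.≤ + 128 ℤ.* k →
    + P ℤ.≤ + n ℤ.* + n ℤ.* (+ n ℤ.* + n) → + e ℤ.* + P ℤ.≤ + 384 ℤ.* k ℤ.* + (n ℕ.* n)
  rescale n e P d k ne≤3d nd≤128k P≤n⁴ = begin
    + e ℤ.* + P
      ≤⟨ ℤ.*-monoˡ-≤-nonNeg (+ e) P≤n⁴ ⟩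
    + e ℤ.* (+ n ℤ.* + n ℤ.* (+ n ℤ.* + n))
      ≡⟨ lemma₁ (+ e) (+ n) ⟩
    + n ℤ.* (+ n ℤ.* + e) ℤ.* (+ n ℤ.* + n)
      ≡⟨ cong (+ n ℤ.* (+ n ℤ.* + e) ℤ.*_) (ℤ.pos-* n n) ⟨
    + n ℤ.* (+ n ℤ.* + e) ℤ.* + (n ℕ.* n)
      ≤⟨ ℤ.*-monoʳ-≤-nonNeg (+ (n ℕ.* n)) (begin
           + n ℤ.* (+ n ℤ.* + e)  ≤⟨ ℤ.*-monoˡ-≤-nonNeg (+ n) ne≤3d ⟩
           + n ℤ.* (+ 3 ℤ.* d)    ≡⟨ lemma₂ (+ n) d ⟩
           + 3 ℤ.* (+ n ℤ.* d)    ≤⟨ ℤ.*-monoˡ-≤-nonNeg (+ 3) nd≤128k ⟩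
           + 3 ℤ.* (+ 128 ℤ.* k)  ≡⟨ ℤ.*-assoc (+ 3) (+ 128) k ⟨
           + 384 ℤ.* k            ∎) ⟩
    + 384 ℤ.* k ℤ.* + (n ℕ.* n) ∎
    where
    open ℤ.≤-Reasoning
    lemma₁ : ∀ e n → e ℤ.* (n ℤ.* n ℤ.* (n ℤ.* n)) ≡ n ℤ.* (n ℤ.* e) ℤ.* (n ℤ.* n)
    lemma₁ = solve-∀
    lemma₂ : ∀ n d → n ℤ.* (+ 3 ℤ.* d) ≡ + 3 ℤ.* (n ℤ.* d)
    lemma₂ = solve-∀

  -- The maximum for order a + b and estimates of the falling factorial

  module Extremal (a b : ℕ) (bal : Balanced (+ a) (+ b)) (large : 20 ℕ.≤ a ℕ.+ b) where

    n = a ℕ.+ b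
    ν = + a ℤ.* + b
    μ = (+ a ℤ.- 1ℤ) ℤ.* (+ b ℤ.- 1ℤ)
    M = + 2 ℤ.* (ν ℤ.* μ)

    typical : Typical (+ n) ν μ
    typical = subst (λ m → Typical m ν μ) (sym (ℤ.pos-+ a b))
      (balanced-typical bal (subst (+ 20 ℤ.≤_) (ℤ.pos-+ a b) (ℤ.+≤+ large)))

    deficit : ∀ (G : Graph n) → + n ℤ.* defect G ℤ.≤ + 128 ℤ.* (M ℤ.- + embeddings H₄ G)
    deficit G = ≤-by (ℤ.i≤j⇒0≤j-i (embeddings-stability G typical)) (lemma (+ embeddings H₄ G) (+ n ℤ.* defect G) μ ν)
      where
      lemma : ∀ e d μ ν → + 256 ℤ.* (μ ℤ.* ν) ℤ.- (+ 128 ℤ.* e ℤ.+ d) ≡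
        + 128 ℤ.* (+ 2 ℤ.* (ν ℤ.* μ) ℤ.- e) ℤ.- d
      lemma = solve-∀

    defect≥0 : ∀ (G : Graph n) → 0ℤ ℤ.≤ defect G
    defect≥0 G = ∑-nonneg n λ u → ∑-nonneg n λ v → ~≥0 G u v ⊗ (common-non≥0 G u v ⊕ common≥0 G u v)

    embeddings≤M : ∀ (G : Graph n) → + embeddings H₄ G ℤ.≤ M
    embeddings≤M G = ℤ.0≤i-j⇒j≤i (ℤ.*-cancelˡ-≤-pos 0ℤ _ (+ 128)
      (ℤ.≤-trans (num n ⊗ defect≥0 G) (deficit G)))

    module _ (4≤n : 4 ℕ.≤ n) where
      private instance
        P-nonZero : ℕ.NonZero (n P′ 4)
        P-nonZero = P′-nonZero 4≤n

      maxDensity≡ : maxDensity H₄ n 4≤n ≡ M / (n P′ 4)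
      maxDensity≡ = ≤-antisym
        (maxDensity-≤ H₄ n 4≤n embeddings≤M)
        (≤-maxDensity H₄ (completeBipartite a b) 4≤n (completeBipartite-embeddings a b))

    falling≡ : + (n P′ 4) ≡ (+ n ℤ.- + 3) ℤ.* ((+ n ℤ.- + 2) ℤ.* ((+ n ℤ.- 1ℤ) ℤ.* + n))
    falling≡ = begin
      + (n P′ 4)
        ≡⟨ trans (ℤ.pos-* (n ℕ.∸ 3) _) (cong (+ (n ℕ.∸ 3) ℤ.*_) (trans (ℤ.pos-* (n ℕ.∸ 2) _) (cong (+ (n ℕ.∸ 2) ℤ.*_) (ℤ.pos-* (n ℕ.∸ 1) _)))) ⟩
      + (n ℕ.∸ 3) ℤ.* (+ (n ℕ.∸ 2) ℤ.* (+ (n ℕ.∸ 1) ℤ.* + (n ℕ.* 1)))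
        ≡⟨ cong₂ ℤ._*_ (minus 3) (cong₂ ℤ._*_ (minus 2) (cong₂ ℤ._*_ (minus 1) (cong +_ (ℕ.*-identityʳ n)))) ⟩
      (+ n ℤ.- + 3) ℤ.* ((+ n ℤ.- + 2) ℤ.* ((+ n ℤ.- 1ℤ) ℤ.* + n)) ∎
      where
      open ≡-Reasoning
      -- Truncated subtraction agrees with integer subtraction since k ≤ 20 ≤ n; the first
      -- inequality is decided by evaluation.
      minus : ∀ k {k≤20 : T (k ℕ.≤ᵇ 20)} → + (n ℕ.∸ k) ≡ + n ℤ.- + k
      minus k {k≤20} = trans (sym (ℤ.⊖-≥ k≤n)) (sym (ℤ.m-n≡m⊖n n k))
        where
        k≤n = ℕ.≤-trans (ℕ.≤ᵇ⇒≤ k 20 k≤20) large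

    private
      m = ℤ.i≤j⇒0≤j-i (Typical.large typical)

    falling≤ : + (n P′ 4) ℤ.≤ + n ℤ.* + n ℤ.* (+ n ℤ.* + n)
    falling≤ = subst (ℤ._≤ + n ℤ.* + n ℤ.* (+ n ℤ.* + n)) (sym falling≡)
      (≤-by (num n ⊗ (num 6 ⊗ m ⊗ num n ⊕ num 109 ⊗ num n ⊕ num 6)) (lemma (+ n)))
      where
      lemma : ∀ n → n ℤ.* (+ 6 ℤ.* (n ℤ.- + 20) ℤ.* n ℤ.+ + 109 ℤ.* n ℤ.+ + 6)
        ≡ n ℤ.* n ℤ.* (n ℤ.* n) ℤ.- (n ℤ.- + 3) ℤ.* ((n ℤ.- + 2) ℤ.* ((n ℤ.- 1ℤ) ℤ.* n))
      lemma = solve-∀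

    falling≥ : + n ℤ.* + n ℤ.* (+ n ℤ.* + n) ℤ.≤ + 8 ℤ.* + (n P′ 4)
    falling≥ = subst (λ p → + n ℤ.* + n ℤ.* (+ n ℤ.* + n) ℤ.≤ + 8 ℤ.* p) (sym falling≡)
      (≤-by (num n ⊗ (m ⊗ (num 7 ⊗ num n ⊗ num n ⊕ num 92 ⊗ num n ⊕ num 1928) ⊕ num 38512)) (lemma (+ n)))
      where
      lemma : ∀ n → n ℤ.* ((n ℤ.- + 20) ℤ.* (+ 7 ℤ.* n ℤ.* n ℤ.+ + 92 ℤ.* n ℤ.+ + 1928) ℤ.+ + 38512)
        ≡ + 8 ℤ.* ((n ℤ.- + 3) ℤ.* ((n ℤ.- + 2) ℤ.* ((n ℤ.- 1ℤ) ℤ.* n))) ℤ.- n ℤ.* n ℤ.* (n ℤ.* n)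
      lemma = solve-∀

    -- 16 ν μ is at least (n² - 1) ((n - 2)² - 1) = (n - 1)² (n + 1) (n - 3), which exceeds the
    -- falling factorial by (n - 1) (n - 3) (2 n - 1). Thus 1/8 is approached from above.
    falling≤8M : + (n P′ 4) ℤ.≤ + 8 ℤ.* M
    falling≤8M = subst (ℤ._≤ + 8 ℤ.* M) (sym falling≡)
      (≤-by (i≥j ν-lower ⊗ (num 4 ⊗ μ≥0) ⊕ (m ⊗ (num n ⊕ num 20) ⊕ num 399) ⊗ i≥j μ-lower
             ⊕ (m ⊕ num 19) ⊗ (m ⊕ num 17) ⊗ (num 2 ⊗ m ⊕ num 39)) (lemma (+ n) ν μ))
      where
      open Typical typical
      i≥j : ∀ {i j} → i ℤ.≤ j → 0ℤ ℤ.≤ j ℤ.- i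
      i≥j = ℤ.i≤j⇒0≤j-i
      lemma : ∀ n ν μ →
        (+ 4 ℤ.* ν ℤ.- (n ℤ.* n ℤ.- 1ℤ)) ℤ.* (+ 4 ℤ.* μ)
        ℤ.+ ((n ℤ.- + 20) ℤ.* (n ℤ.+ + 20) ℤ.+ + 399) ℤ.* (+ 4 ℤ.* μ ℤ.- ((n ℤ.- + 2) ℤ.* (n ℤ.- + 2) ℤ.- 1ℤ))
        ℤ.+ ((n ℤ.- + 20) ℤ.+ + 19) ℤ.* ((n ℤ.- + 20) ℤ.+ + 17) ℤ.* (+ 2 ℤ.* (n ℤ.- + 20) ℤ.+ + 39)
        ≡ + 8 ℤ.* (+ 2 ℤ.* (ν ℤ.* μ)) ℤ.- (n ℤ.- + 3) ℤ.* ((n ℤ.- + 2) ℤ.* ((n ℤ.- 1ℤ) ℤ.* n))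
      lemma = solve-∀

    -- Both terms on the left have leading part n⁴, so an error of order n³ remains and the density
    -- exceeds 1/8 by O(1/n).
    8M-falling≤ : + 8 ℤ.* M ℤ.- + (n P′ 4) ℤ.≤ + 2 ℤ.* (+ n ℤ.* + n ℤ.* + n)
    8M-falling≤ = subst (λ p → + 8 ℤ.* M ℤ.- p ℤ.≤ + 2 ℤ.* (+ n ℤ.* + n ℤ.* + n)) (sym falling≡)
      (subst (λ x → + 8 ℤ.* M ℤ.- (x ℤ.- + 3) ℤ.* ((x ℤ.- + 2) ℤ.* ((x ℤ.- 1ℤ) ℤ.* x)) ℤ.≤ + 2 ℤ.* (x ℤ.* x ℤ.* x)) (sym (ℤ.pos-+ a b))
        (≤-by ((μ≥0 ⊗ num 4) ⊗ square≥0 (+ a ℤ.- + b)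
               ⊕ (num a ⊕ num b) ⊗ (num a ⊕ num b) ⊗ square≥0 (+ a ℤ.- + b)
               ⊕ (num a ⊕ num b) ⊗ (num 7 ⊗ m′ ⊕ num 134)) (lemma (+ a) (+ b))))
      where
      open Typical typical
      m′ = subst (λ x → 0ℤ ℤ.≤ x ℤ.- + 20) (ℤ.pos-+ a b) m
      -- 16 ν μ = ((a+b)² − (a−b)²) · 4 μ with 4 μ = (a+b−2)² − (a−b)²
      lemma : ∀ a b →
        (a ℤ.- 1ℤ) ℤ.* (b ℤ.- 1ℤ) ℤ.* + 4 ℤ.* ((a ℤ.- b) ℤ.* (a ℤ.- b))
        ℤ.+ (a ℤ.+ b) ℤ.* (a ℤ.+ b) ℤ.* ((a ℤ.- b) ℤ.* (a ℤ.- b))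
        ℤ.+ (a ℤ.+ b) ℤ.* (+ 7 ℤ.* (a ℤ.+ b ℤ.- + 20) ℤ.+ + 134)
        ≡ + 2 ℤ.* ((a ℤ.+ b) ℤ.* (a ℤ.+ b) ℤ.* (a ℤ.+ b))
          ℤ.- (+ 8 ℤ.* (+ 2 ℤ.* (a ℤ.* b ℤ.* ((a ℤ.- 1ℤ) ℤ.* (b ℤ.- 1ℤ))))
            ℤ.- (a ℤ.+ b ℤ.- + 3) ℤ.* ((a ℤ.+ b ℤ.- + 2) ℤ.* ((a ℤ.+ b ℤ.- 1ℤ) ℤ.* (a ℤ.+ b))))
      lemma = solve-∀

    edit-bound : ∀ (G : Graph n) → ∃[ x ]
      + editDistance G (blowup K₂ (neighbour-part G x)) ℤ.* + (n P′ 4)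
        ℤ.≤ + 384 ℤ.* (M ℤ.- + embeddings H₄ G) ℤ.* + (n ℕ.* n)
    edit-bound G = map₂
      (λ {x} avg → rescale n (editDistance G (blowup K₂ (neighbour-part G x))) (n P′ 4) (defect G) (M ℤ.- + embeddings H₄ G)
            avg (deficit G) falling≤)
      (editDistance-bound G {{ℕ.>-nonZero (ℕ.<-≤-trans (ℕ.s≤s ℕ.z≤n) large)}})

  -- Stability and the limit in terms of densities

  clear-denominator : ∀ e C N M Λ P .{{_ : ℕ.NonZero P}} →
    + e ℤ.* + P ℤ.≤ + C ℤ.* (M ℤ.- Λ) ℤ.* + N → fromℕ e ≤ fromℕ C * (M / P - Λ / P) * fromℕ N
  clear-denominator e C N M Λ P bound = *-cancelʳ-≤-pos (ι (+ P)) {{ι-positive P}} (begin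
    ι (+ e) * ι (+ P)
      ≡⟨ ι-* (+ e) (+ P) ⟨
    ι (+ e ℤ.* + P)
      ≤⟨ ι-mono-≤ bound ⟩
    ι (+ C ℤ.* (M ℤ.- Λ) ℤ.* + N)
      ≡⟨ trans (ι-* (+ C ℤ.* (M ℤ.- Λ)) (+ N)) (cong (_* ι (+ N)) (trans (ι-* (+ C) (M ℤ.- Λ)) (cong (ι (+ C) *_) (ι-- M Λ)))) ⟩
    ι (+ C) * (ι M - ι Λ) * ι (+ N)
      ≡⟨ cong₂ (λ m l → ι (+ C) * (m - l) * ι (+ N)) (/-*-ι M P) (/-*-ι Λ P) ⟨
    ι (+ C) * (M / P * ι (+ P) - Λ / P * ι (+ P)) * ι (+ N)
      ≡⟨ factor (ι (+ C)) (M / P) (Λ / P) (ι (+ P)) (ι (+ N)) ⟩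
    ι (+ C) * (M / P - Λ / P) * ι (+ N) * ι (+ P) ∎)
    where
    open ≤-Reasoning
    factor : ∀ c m l p n → c * (m * p - l * p) * n ≡ c * (m - l) * n * p
    factor = solve 5 (λ c m l p n → c :* (m :* p :- l :* p) :* n := c :* (m :- l) :* n :* p) refl

  stability-transfer : ∀ {κ n} (H : ColouredGraph κ) (G : Graph n) (κ≤n : κ ℕ.≤ n) M →
    maxDensity H n κ≤n ≡ (M / (n P′ κ)) {{P′-nonZero κ≤n}} → ∀ e C N →
    + e ℤ.* + (n P′ κ) ℤ.≤ + C ℤ.* (M ℤ.- + embeddings H G) ℤ.* + N →
    fromℕ e ≤ fromℕ C * (maxDensity H n κ≤n - density H G κ≤n) * fromℕ N
  stability-transfer {κ} {n} H G κ≤n M max≡ e C N bound =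
    subst (λ d → fromℕ e ≤ fromℕ C * (d - density H G κ≤n) * fromℕ N) (sym max≡)
      (clear-denominator e C N M (+ embeddings H G) (n P′ κ) {{P′-nonZero κ≤n}} bound)

  -- The excess over 1/8 is (8 M - P) / (8 P), at most 2 / n. If d is the denominator of ε then ε ≥
  -- 1 / d, and n ≥ 3 d makes 2 / n smaller than that.
  near-eighth : ∀ n P .{{_ : ℕ.NonZero P}} M → 20 ℕ.≤ n → + P ℤ.≤ + 8 ℤ.* M →
    + 8 ℤ.* M ℤ.- + P ℤ.≤ + 2 ℤ.* (+ n ℤ.* + n ℤ.* + n) → + n ℤ.* + n ℤ.* (+ n ℤ.* + n) ℤ.≤ + 8 ℤ.* + P →
    ∀ ε → 0ℚ < ε → 3 ℕ.* ↧ₙ ε ℕ.≤ n → ∣ M / P - + 1 / 8 ∣ < ε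
  near-eighth n P M 20≤n P≤8M 8M-P≤ n⁴≤8P ε@(mkℚ (+ 0) _ _) 0<ε 3d≤n with () ← positive 0<ε
  near-eighth n P M 20≤n P≤8M 8M-P≤ n⁴≤8P ε@(mkℚ ℤ.-[1+ _ ] _ _) 0<ε 3d≤n with () ← positive 0<ε
  near-eighth n@(suc _) P@(suc _) M 20≤n P≤8M 8M-P≤ n⁴≤8P ε@(mkℚ ℤ.+[1+ k ] d-1 _) 0<ε 3d≤n =
    subst (_< ε) (sym (0≤p⇒∣p∣≡p q≥0)) q<ε
    where
    open ≤-Reasoning
    d = ↧ₙ ε
    q = M / P - + 1 / 8

    q-cleared : q * ι (+ 8 ℤ.* + P) ≡ ι (+ 8 ℤ.* M ℤ.- + P)
    q-cleared = trans (cong (q *_) (ι-* (+ 8) (+ P))) (trans (factor (M / P) (ι (+ P)))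
      (trans (cong (λ m → ι (+ 8) * m - ι (+ P)) (/-*-ι M P))
        (sym (trans (ι-- (+ 8 ℤ.* M) (+ P)) (cong (_- ι (+ P)) (ι-* (+ 8) M))))))
      where
      factor : ∀ m p → (m - + 1 / 8) * (ι (+ 8) * p) ≡ ι (+ 8) * (m * p) - p
      factor = solve 2 (λ m p → (m :- con (+ 1 / 8)) :* (con (ι (+ 8)) :* p) := con (ι (+ 8)) :* (m :* p) :- p) refl

    q≥0 : 0ℚ ≤ q
    q≥0 = *-cancelʳ-≤-pos (ι (+ 8 ℤ.* + P)) {{ι-positive (8 ℕ.* P)}} (begin
      0ℚ * ι (+ 8 ℤ.* + P)      ≡⟨ *-zeroˡ (ι (+ 8 ℤ.* + P)) ⟩
      ι 0ℤ                      ≤⟨ ι-mono-≤ (ℤ.i≤j⇒0≤j-i P≤8M) ⟩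
      ι (+ 8 ℤ.* M ℤ.- + P)     ≡⟨ q-cleared ⟨
      q * ι (+ 8 ℤ.* + P)       ∎)

    -- Using 3 d ≤ n rather than 2 d ≤ n leaves a spare n³ d ≥ 1, which makes the inequality strict.
    numerators : (+ 8 ℤ.* M ℤ.- + P) ℤ.* + d ℤ.< + suc k ℤ.* (+ 8 ℤ.* + P)
    numerators = ℤ.suc[i]≤j⇒i<j (≤-by
      (ℤ.i≤j⇒0≤j-i 8M-P≤ ⊗ num d ⊕ num n ⊗ num n ⊗ num n ⊗ ℤ.i≤j⇒0≤j-i 3d≤n′
        ⊕ ℤ.i≤j⇒0≤j-i n⁴≤8P ⊕ num k ⊗ (num 8 ⊗ num P)
        ⊕ ℤ.i≤j⇒0≤j-i (ℤ.+≤+ {1} {n ℕ.* n ℕ.* n ℕ.* d} (ℕ.s≤s ℕ.z≤n)))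
      (trans (cong (λ x → (+ 2 ℤ.* (+ n ℤ.* + n ℤ.* + n) ℤ.- (+ 8 ℤ.* M ℤ.- + P)) ℤ.* + d
          ℤ.+ + n ℤ.* + n ℤ.* + n ℤ.* (+ n ℤ.- + 3 ℤ.* + d)
          ℤ.+ (+ 8 ℤ.* + P ℤ.- + n ℤ.* + n ℤ.* (+ n ℤ.* + n))
          ℤ.+ + k ℤ.* (+ 8 ℤ.* + P) ℤ.+ (x ℤ.- 1ℤ)) n³d)
        (trans (lemma (+ n) (+ d) (+ 8 ℤ.* M ℤ.- + P) (+ 8 ℤ.* + P) (+ k))
          (cong (λ s → s ℤ.* (+ 8 ℤ.* + P) ℤ.- (1ℤ ℤ.+ (+ 8 ℤ.* M ℤ.- + P) ℤ.* + d)) (sym (ℤ.pos-+ 1 k))))))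
      where
      3d≤n′ : + 3 ℤ.* + d ℤ.≤ + n
      3d≤n′ = subst (ℤ._≤ + n) (ℤ.pos-* 3 d) (ℤ.+≤+ 3d≤n)
      n³d : + (n ℕ.* n ℕ.* n ℕ.* d) ≡ + n ℤ.* + n ℤ.* + n ℤ.* + d
      n³d = trans (ℤ.pos-* (n ℕ.* n ℕ.* n) d) (cong (ℤ._* + d) (trans (ℤ.pos-* (n ℕ.* n) n) (cong (ℤ._* + n) (ℤ.pos-* n n))))
      lemma : ∀ n d x p k →
        (+ 2 ℤ.* (n ℤ.* n ℤ.* n) ℤ.- x) ℤ.* d ℤ.+ n ℤ.* n ℤ.* n ℤ.* (n ℤ.- + 3 ℤ.* d)
          ℤ.+ (p ℤ.- n ℤ.* n ℤ.* (n ℤ.* n)) ℤ.+ k ℤ.* p ℤ.+ (n ℤ.* n ℤ.* n ℤ.* d ℤ.- 1ℤ)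
        ≡ (1ℤ ℤ.+ k) ℤ.* p ℤ.- (1ℤ ℤ.+ x ℤ.* d)
      lemma = solve-∀

    q<ε : q < ε
    q<ε = *-cancelʳ-<-nonNeg (ι (+ 8 ℤ.* + P) * ι (+ d))
      {{pos⇒nonNeg (ι (+ 8 ℤ.* + P) * ι (+ d)) {{pos*pos⇒pos (ι (+ 8 ℤ.* + P)) {{ι-positive (8 ℕ.* P)}} (ι (+ d)) {{ι-positive d}}}}}} (begin-strict
      q * (ι (+ 8 ℤ.* + P) * ι (+ d))
        ≡⟨ trans (sym (*-assoc q (ι (+ 8 ℤ.* + P)) (ι (+ d)))) (trans (cong (_* ι (+ d)) q-cleared) (sym (ι-* (+ 8 ℤ.* M ℤ.- + P) (+ d)))) ⟩
      ι ((+ 8 ℤ.* M ℤ.- + P) ℤ.* + d)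
        <⟨ ι-mono-< numerators ⟩
      ι (+ suc k ℤ.* (+ 8 ℤ.* + P))
        ≡⟨ ι-* (+ suc k) (+ 8 ℤ.* + P) ⟩
      ι (+ suc k) * ι (+ 8 ℤ.* + P)
        ≡⟨ cong (_* ι (+ 8 ℤ.* + P)) (trans (sym (/-*-ι (+ suc k) d)) (cong (_* ι (+ d)) (↥p/↧p≡p ε))) ⟩
      ε * ι (+ d) * ι (+ 8 ℤ.* + P)
        ≡⟨ trans (*-assoc ε (ι (+ d)) (ι (+ 8 ℤ.* + P))) (cong (ε *_) (*-comm (ι (+ d)) (ι (+ 8 ℤ.* + P)))) ⟩
      ε * (ι (+ 8 ℤ.* + P) * ι (+ d)) ∎)

  -- The extremal graph lives on `Fin (a + b)`. The passage to `Fin n` is made once, for an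
  -- arbitrary predicate; `Close` and `StableAt` are stated as predicates of n for this purpose.
  by-halves : ∀ (P : ℕ → Set) →
    (∀ a b → Balanced (+ a) (+ b) → 20 ℕ.≤ a ℕ.+ b → P (a ℕ.+ b)) → ∀ n → 20 ℕ.≤ n → P n
  by-halves P step n 20≤n = subst P (ℕ.⌊n/2⌋+⌈n/2⌉≡n n)
    (step ℕ.⌊ n /2⌋ ℕ.⌈ n /2⌉ (balanced-halves n) (subst (20 ℕ.≤_) (sym (ℕ.⌊n/2⌋+⌈n/2⌉≡n n)) 20≤n))

  Close : ℚ → ℕ → Set
  Close ε n = 3 ℕ.* ↧ₙ ε ℕ.≤ n → (4≤n : 4 ℕ.≤ n) → ∣ maxDensity H₄ n 4≤n - + 1 / 8 ∣ < ε

  StableAt : ℕ → ℕ → Set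
  StableAt C n = (4≤n : 4 ℕ.≤ n) (G : Graph n) → Σ[ part ∈ (Fin n → Fin 2) ]
    fromℕ (editDistance G (blowup K₂ part))
      ≤ fromℕ C * (maxDensity H₄ n 4≤n - density H₄ G 4≤n) * fromℕ (n ℕ.* n)

  close : ∀ ε → 0ℚ < ε → ∀ n → 20 ℕ.≤ n → Close ε n
  close ε 0<ε = by-halves (Close ε) λ a b bal large 3d≤n 4≤n →
    let open Extremal a b bal large in
    subst (λ d → ∣ d - + 1 / 8 ∣ < ε) (sym (maxDensity≡ 4≤n))
      (near-eighth n (n P′ 4) {{P′-nonZero 4≤n}} M large falling≤8M 8M-falling≤ falling≥ ε 0<ε 3d≤n)

  stable : ∀ n → 20 ℕ.≤ n → StableAt 384 n
  stable = by-halves (StableAt 384) λ a b bal large 4≤n G →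
    let open Extremal a b bal large
        x , bound = edit-bound G
    in neighbour-part G x
     , stability-transfer H₄ G 4≤n M (maxDensity≡ 4≤n)
         (editDistance G (blowup K₂ (neighbour-part G x))) 384 (n ℕ.* n) bound

  limitDensity : LimitDensity H₄ (+ 1 / 8)
  limitDensity ε 0<ε = 20 ℕ.⊔ 3 ℕ.* ↧ₙ ε , λ n N≤n →
    close ε 0<ε n (ℕ.m⊔n≤o⇒m≤o 20 (3 ℕ.* ↧ₙ ε) N≤n) (ℕ.m⊔n≤o⇒n≤o 20 (3 ℕ.* ↧ₙ ε) N≤n)

  perfectlyStable : PerfectlyStable H₄ K₂
  -- The same number has to serve as factor and as threshold for n; 384 is beyond the threshold 20.
  perfectlyStable = 384 , ℕ.s≤s ℕ.z≤n , λ n 384≤n → stable n (ℕ.≤-trans (ℕ.≤ᵇ⇒≤ 20 384 _) 384≤n)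

-- The unique maximizer on `K₂`

module Maximizer where

  open import Data.Rational.Base hiding (_/_; ½)
  open import Data.Rational.Properties
  open +-*-Solver

  infixl 6 _⊕_ _⊕<_
  infixl 7 _⊗_

  _⊕_ : ∀ {x y} → 0ℚ ≤ x → 0ℚ ≤ y → 0ℚ ≤ x + y
  _⊕_ = +-mono-≤

  _⊕<_ : ∀ {x y} → 0ℚ ≤ x → 0ℚ < y → 0ℚ < x + y
  _⊕<_ = +-mono-≤-<

  _⊗_ : ∀ {x y} → 0ℚ ≤ x → 0ℚ ≤ y → 0ℚ ≤ x * y
  _⊗_ {x} {y} 0≤x 0≤y = subst (_≤ x * y) (*-zeroʳ x) (*-monoˡ-≤-nonNeg x {{nonNegative 0≤x}} 0≤y)

  const≥0 : ∀ q {_ : NonNegative q} → 0ℚ ≤ q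
  const≥0 q {nn} = nonNegative⁻¹ q {{nn}}

  0<* : ∀ {x y} → 0ℚ < x → 0ℚ < y → 0ℚ < x * y
  0<* {x} {y} 0<x 0<y = positive⁻¹ (x * y) {{pos*pos⇒pos x {{positive 0<x}} y {{positive 0<y}}}}

  difference≥0 : ∀ {x y} → x ≤ y → 0ℚ ≤ y - x
  difference≥0 {x} {y} x≤y = subst (_≤ y - x) (+-inverseʳ x) (+-monoˡ-≤ (- x) x≤y)

  difference>0 : ∀ {x y} → x < y → 0ℚ < y - x
  difference>0 {x} {y} x<y = subst (_< y - x) (+-inverseʳ x) (+-monoˡ-< (- x) x<y)

  <-by : ∀ {x y z} → 0ℚ < z → z ≡ y - x → x < y
  <-by {x} {y} 0<z refl = subst₂ _<_ (+-identityˡ x)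
    (solve 2 (λ x y → (y :- x) :+ x := y) refl x y) (+-monoˡ-< x 0<z)

  square≥0 : ∀ x → 0ℚ ≤ x * x
  square≥0 x with ≤-total 0ℚ x
  ... | inj₁ 0≤x = 0≤x ⊗ 0≤x
  ... | inj₂ x≤0 = subst (0ℚ ≤_) (solve 1 (λ x → :- x :* :- x := x :* x) refl x) (0≤-x ⊗ 0≤-x)
    where 0≤-x = neg-antimono-≤ x≤0

  ∣∣<⇒< : ∀ {x ε} → ∣ x ∣ < ε → x < ε
  ∣∣<⇒< {x} ∣x∣<ε with ≤-total 0ℚ x
  ... | inj₁ 0≤x = subst (_< _) (0≤p⇒∣p∣≡p 0≤x) ∣x∣<ε
  ... | inj₂ x≤0 = ≤-<-trans (≤-trans x≤0 (0≤∣p∣ x)) ∣x∣<ε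

  ∣∣<⇒-< : ∀ {x ε} → ∣ x ∣ < ε → - x < ε
  ∣∣<⇒-< {x} ∣x∣<ε = ∣∣<⇒< (subst (_< _) (sym (∣-p∣≡∣p∣ x)) ∣x∣<ε)

  <⇒∣∣< : ∀ {x ε} → x < ε → - x < ε → ∣ x ∣ < ε
  <⇒∣∣< {x} x<ε -x<ε with ∣p∣≡p∨∣p∣≡-p x
  ... | inj₁ eq = subst (_< _) (sym eq) x<ε
  ... | inj₂ eq = subst (_< _) (sym eq) -x<ε

  square-cancel-< : ∀ {x ε} → 0ℚ < ε → x * x < ε * ε → x < ε
  square-cancel-< {x} {ε} 0<ε x²<ε² with x <? ε
  ... | yes x<ε = x<ε
  ... | no  x≮ε = contradiction (<-≤-trans x²<ε² (begin
      ε * ε                                  ≡⟨ +-identityˡ (ε * ε) ⟨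
      0ℚ + ε * ε                             ≤⟨ +-monoˡ-≤ (ε * ε) (d ⊗ (d ⊕ (<⇒≤ 0<ε ⊕ <⇒≤ 0<ε))) ⟩
      (x - ε) * ((x - ε) + (ε + ε)) + ε * ε  ≡⟨ solve 2 (λ x ε → (x :- ε) :* ((x :- ε) :+ (ε :+ ε)) :+ ε :* ε := x :* x) refl x ε ⟩
      x * x                                  ∎)) (<-irrefl refl)
    where
    open ≤-Reasoning
    d = difference≥0 (≮⇒≥ x≮ε)

  -- λ_H(K₂(x , y)) and x + y, written as they unfold from the definitions.
  density₂ mass₂ : ℚ → ℚ → ℚ
  density₂ x y = x * (x * (y * (y * 1ℚ))) + (y * (y * (x * (x * 1ℚ))) + 0ℚ)
  mass₂ x y = x + (y + 0ℚ)

  private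
    q : ℕ → (d : ℕ) .{{_ : ℕ.NonZero d}} → ℚ
    q n d = + n / d

  module _ (x y : ℚ) where

    private
      t = mass₂ x y - 1ℚ
      -- Equal to (x + y)² + 4 x y - 3/16, arranged so that it is visibly nonnegative under the
      -- margins assumed below. The 3/16 split off gives a positive multiple of (x - y)².
      h = q 4 1 * ((x + q 1 16) * (y + q 1 16)) + ((q 1 4 + t) * (q 1 4 + t) + q 5 4 * (q 1 4 + t) + q 11 64)

    -- With t = x + y - 1, the deviations x - 1/2 and y - 1/2 are the means of t with x - y and with
    -- y - x.
    near-half : ∀ ε → 0ℚ < ε → ∣ t ∣ < ε → (x - y) * (x - y) < ε * ε → ∣ x - ½ ∣ < ε × ∣ y - ½ ∣ < ε
    near-half ε 0<ε t<ε d²<ε² =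
        <⇒∣∣< (<-by (mean (∣∣<⇒< t<ε) d<ε) (solve 3 (λ x y ε → con ½ :* (ε :- t′ x y) :+ con ½ :* (ε :- (x :- y)) := ε :- (x :- con ½)) refl x y ε))
              (<-by (mean (∣∣<⇒-< {t} t<ε) -d<ε) (solve 3 (λ x y ε → con ½ :* (ε :- :- t′ x y) :+ con ½ :* (ε :- (y :- x)) := ε :- :- (x :- con ½)) refl x y ε))
      , <⇒∣∣< (<-by (mean (∣∣<⇒< t<ε) -d<ε) (solve 3 (λ x y ε → con ½ :* (ε :- t′ x y) :+ con ½ :* (ε :- (y :- x)) := ε :- (y :- con ½)) refl x y ε))
              (<-by (mean (∣∣<⇒-< {t} t<ε) d<ε) (solve 3 (λ x y ε → con ½ :* (ε :- :- t′ x y) :+ con ½ :* (ε :- (x :- y)) := ε :- :- (y :- con ½)) refl x y ε))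
      where
      t′ : ∀ {n} → Polynomial n → Polynomial n → Polynomial n
      t′ x y = x :+ (y :+ con 0ℚ) :- con 1ℚ
      d<ε : x - y < ε
      d<ε = square-cancel-< 0<ε d²<ε²
      -d<ε : y - x < ε
      -d<ε = square-cancel-< 0<ε (subst (_< ε * ε) (solve 2 (λ x y → (x :- y) :* (x :- y) := (y :- x) :* (y :- x)) refl x y) d²<ε²)
      mean : ∀ {u v} → u < ε → v < ε → 0ℚ < ½ * (ε - u) + ½ * (ε - v)
      mean u<ε v<ε = <⇒≤ (0<* (positive⁻¹ ½) (difference>0 u<ε)) ⊕< 0<* (positive⁻¹ ½) (difference>0 v<ε)

    -- For a real vector in the simplex the approximating rationals satisfy x, y ≥ 0 and x + y = 1
    -- only up to an error. The fixed margins 1/16 and 1/4 hold eventually and keep `h` nonnegative.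
    module _ (x≥ : 0ℚ < x + q 1 16) (y≥ : 0ℚ < y + q 1 16) (t< : ∣ t ∣ < q 1 4) where

      private
        t⁻ : 0ℚ ≤ q 1 4 - t
        t⁻ = difference≥0 (<⇒≤ (∣∣<⇒< t<))

        t⁺ : 0ℚ ≤ q 1 4 + t
        t⁺ = subst (0ℚ ≤_) (solve 1 (λ t → con (q 1 4) :- :- t := con (q 1 4) :+ t) refl t)
               (difference≥0 (<⇒≤ (∣∣<⇒-< {t} t<)))

        -- This is g = (t + 2) ((t + 1)² + 1), the factor in (1 + t)⁴ - 1 = t g; the expression in
        -- `g≤8` is 8 - g.
        g≥0 : 0ℚ ≤ (q 1 4 + t + q 7 4) * ((t + 1ℚ) * (t + 1ℚ) + 1ℚ)
        g≥0 = (t⁺ ⊕ const≥0 (q 7 4)) ⊗ (square≥0 (t + 1ℚ) ⊕ const≥0 1ℚ)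

        g≤8 : 0ℚ ≤ q 6 1 * (q 1 4 - t) + q 17 4 * ((q 1 4 - t) * (q 1 4 + t)) + t * t * (q 1 4 - t) + q 143 64
        g≤8 = const≥0 (q 6 1) ⊗ t⁻ ⊕ const≥0 (q 17 4) ⊗ (t⁻ ⊗ t⁺) ⊕ square≥0 t ⊗ t⁻ ⊕ const≥0 (q 143 64)

        h≥0 : 0ℚ ≤ h
        h≥0 = const≥0 (q 4 1) ⊗ (<⇒≤ x≥ ⊗ <⇒≤ y≥) ⊕ (t⁺ ⊗ t⁺ ⊕ const≥0 (q 5 4) ⊗ t⁺ ⊕ const≥0 (q 11 64))

      -- Mass 1 + t raises the bound 1/8 to (1 + t)⁴ / 8 = 1/8 + t g / 8. As g ≤ 8 and t < ½ ε the
      -- excess is at most ½ ε, and the other half of ε gives strictness.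
      density₂-upper : ∀ ε → 0ℚ < ε → ∣ t ∣ < ½ * ε → density₂ x y < q 1 8 + ε
      density₂-upper ε 0<ε t<½ε = <-by
        (const≥0 (q 1 8) ⊗ (difference≥0 (<⇒≤ (∣∣<⇒< t<½ε)) ⊗ g≥0 ⊕ (const≥0 ½ ⊗ <⇒≤ 0<ε) ⊗ g≤8
            ⊕ square≥0 (x - y) ⊗ (h≥0 ⊕ const≥0 (q 3 16)))
          ⊕< 0<* (positive⁻¹ ½) 0<ε)
        (solve 3 (λ x y ε → let t = x :+ (y :+ con 0ℚ) :- con 1ℚ in
          con (q 1 8) :* ((con ½ :* ε :- t) :* ((con (q 1 4) :+ t :+ con (q 7 4)) :* ((t :+ con 1ℚ) :* (t :+ con 1ℚ) :+ con 1ℚ))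
            :+ con ½ :* ε :* (con (q 6 1) :* (con (q 1 4) :- t) :+ con (q 17 4) :* ((con (q 1 4) :- t) :* (con (q 1 4) :+ t)) :+ t :* t :* (con (q 1 4) :- t) :+ con (q 143 64))
            :+ (x :- y) :* (x :- y) :* (con (q 4 1) :* ((x :+ con (q 1 16)) :* (y :+ con (q 1 16))) :+ ((con (q 1 4) :+ t) :* (con (q 1 4) :+ t) :+ con (q 5 4) :* (con (q 1 4) :+ t) :+ con (q 11 64)) :+ con (q 3 16)))
            :+ con ½ :* ε
          := con (q 1 8) :+ ε :- (x :* (x :* (y :* (y :* con 1ℚ))) :+ (y :* (y :* (x :* (x :* con 1ℚ))) :+ con 0ℚ))) refl x y ε)

      -- Put δ = ε² / 128. Then (x + y)⁴ is at most 1 + 8 δ and 16 x² y² exceeds 1 - 8 δ, so (3/16)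
      -- (x - y)² is below 16 δ = ε² / 8. This bounds (x - y)² by two thirds of ε².
      density₂-stable : ∀ ε → 0ℚ < ε → ∣ t ∣ < q 1 128 * (ε * ε) → q 1 8 < density₂ x y + q 1 128 * (ε * ε) →
        (x - y) * (x - y) < ε * ε
      density₂-stable ε 0<ε t<δ near = <-by
        (const≥0 (q 16 3) ⊗ (square≥0 (x - y) ⊗ h≥0
            ⊕ difference≥0 (<⇒≤ (∣∣<⇒< t<δ)) ⊗ g≥0
            ⊕ (const≥0 (q 1 128) ⊗ (<⇒≤ 0<ε ⊗ <⇒≤ 0<ε)) ⊗ g≤8
            ⊕ const≥0 (q 8 1) ⊗ difference≥0 (<⇒≤ near))
          ⊕< 0<* (positive⁻¹ (q 1 3)) (0<* 0<ε 0<ε))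
        (solve 3 (λ x y ε → let t = x :+ (y :+ con 0ℚ) :- con 1ℚ ; δ = con (q 1 128) :* (ε :* ε) in
          con (q 16 3) :* ((x :- y) :* (x :- y) :* (con (q 4 1) :* ((x :+ con (q 1 16)) :* (y :+ con (q 1 16))) :+ ((con (q 1 4) :+ t) :* (con (q 1 4) :+ t) :+ con (q 5 4) :* (con (q 1 4) :+ t) :+ con (q 11 64)))
            :+ (δ :- t) :* ((con (q 1 4) :+ t :+ con (q 7 4)) :* ((t :+ con 1ℚ) :* (t :+ con 1ℚ) :+ con 1ℚ))
            :+ δ :* (con (q 6 1) :* (con (q 1 4) :- t) :+ con (q 17 4) :* ((con (q 1 4) :- t) :* (con (q 1 4) :+ t)) :+ t :* t :* (con (q 1 4) :- t) :+ con (q 143 64))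
            :+ con (q 8 1) :* (x :* (x :* (y :* (y :* con 1ℚ))) :+ (y :* (y :* (x :* (x :* con 1ℚ))) :+ con 0ℚ) :+ δ :- con (q 1 8)))
            :+ con (q 1 3) :* (ε :* ε)
          := ε :* ε :- (x :- y) :* (x :- y)) refl x y ε)

  Eventually : (ℕ → Set) → Set
  Eventually P = ∃[ N ] ∀ i → N ℕ.≤ i → P i

  infixr 5 _∧ᴱ_

  _∧ᴱ_ : ∀ {P Q : ℕ → Set} → Eventually P → Eventually Q → Eventually (λ i → P i × Q i)
  (M , p) ∧ᴱ (N , q) = M ℕ.⊔ N , λ i M⊔N≤i →
    p i (ℕ.m⊔n≤o⇒m≤o M N M⊔N≤i) , q i (ℕ.m⊔n≤o⇒n≤o M N M⊔N≤i)

  mapᴱ : ∀ {P Q : ℕ → Set} → (∀ {i} → P i → Q i) → Eventually P → Eventually Q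
  mapᴱ f (N , p) = N , λ i N≤i → f (p i N≤i)

  ½-inSimplex : InSimplex {2} (λ _ → fromℚ ½)
  ½-inSimplex = (λ _ ε 0<ε → 0 , λ _ _ → const≥0 ½ ⊕< 0<ε) , λ ε 0<ε → 0 , λ _ _ → 0<ε

  module _ (b : Fin 2 → ℝ) (b∈ : InSimplex b) where
    private
      x y : ℕ → ℚ
      x = seq (b 0F)
      y = seq (b 1F)

      nonneg : ∀ j → Eventually λ i → 0ℚ < seq (b j) i + q 1 16
      nonneg j = proj₁ b∈ j (q 1 16) (positive⁻¹ (q 1 16))

      mass : ∀ ε → 0ℚ < ε → Eventually λ i → ∣ mass₂ (x i) (y i) - 1ℚ ∣ < ε
      mass = proj₂ b∈

    blowupDensity-≤ : blowupDensity H₄ K₂ b ≤ℝ blowupDensity H₄ K₂ (λ _ → fromℚ ½)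
    blowupDensity-≤ ε 0<ε = mapᴱ
      -- Only two of the sixteen maps respect the colours, and evaluation of the filter reduces the
      -- density to `density₂`, with value 1/8 at (1/2, 1/2).
      (λ {i} (x≥ , y≥ , t<¼ , t<½ε) → density₂-upper (x i) (y i) x≥ y≥ t<¼ ε 0<ε t<½ε)
      (nonneg 0F ∧ᴱ nonneg 1F ∧ᴱ mass (q 1 4) (positive⁻¹ (q 1 4)) ∧ᴱ mass (½ * ε) (0<* (positive⁻¹ ½) 0<ε))

    -- Comparison with (1/2, 1/2) alone forces equality: the inequality is used at precision ε² /
    -- 128, which `density₂-stable` turns into closeness ε of the coordinates.
    maximizer-½ : blowupDensity H₄ K₂ (λ _ → fromℚ ½) ≤ℝ blowupDensity H₄ K₂ b → ∀ j → b j ≃ℝ fromℚ ½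
    maximizer-½ ½≤b j ε 0<ε = mapᴱ (λ {i} near → coordinate j i near)
      (mapᴱ (λ {i} (x≥ , y≥ , t<¼ , t<ε , t<δ , close) → near-half (x i) (y i) ε 0<ε t<ε
               (density₂-stable (x i) (y i) x≥ y≥ t<¼ ε 0<ε t<δ close))
        (nonneg 0F ∧ᴱ nonneg 1F ∧ᴱ mass (q 1 4) (positive⁻¹ (q 1 4)) ∧ᴱ mass ε 0<ε ∧ᴱ mass δ 0<δ ∧ᴱ ½≤b δ 0<δ))
      where
      δ = q 1 128 * (ε * ε)
      0<δ = 0<* (positive⁻¹ (q 1 128)) (0<* 0<ε 0<ε)
      coordinate : ∀ j i → ∣ x i - ½ ∣ < ε × ∣ y i - ½ ∣ < ε → ∣ seq (b j) i - ½ ∣ < ε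
      coordinate 0F i = proj₁
      coordinate 1F i = proj₂

  uniqueMaximizer : IsUniqueMaximizer H₄ K₂ (λ _ → fromℚ ½)
  uniqueMaximizer = (½-inSimplex , blowupDensity-≤) ,
    λ b (b∈ , b-max) → maximizer-½ b b∈ (b-max (λ _ → fromℚ ½) ½-inSimplex)

theorem3p12 : LimitDensity H₄ (+ 1 / 8)
    × PerfectlyStable H₄ K₂
    × IsUniqueMaximizer H₄ K₂ (λ _ → fromℚ ½)
theorem3p12 = Densities.limitDensity , Densities.perfectlyStable , Maximizer.uniqueMaximizer
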